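{- There is a function $f(\Delta)=O(\Delta^{4/3})$ (as $\Delta\to\infty$) such that every graph $G$ with maximum degree $\Delta\ge 3$ satisfies $\pi'_l(G)\le \Delta^2 + 2^{4/3}\Delta^{5/3} + f(\Delta)$.
   Context: An edge-coloring is non-repetitive if for every path with an even number $2j$ of edges $e_1,\dots,e_{2j}$ (in order along the path), the color sequence $(c(e_1),\dots,c(e_j))$ differs from $(c(e_{j+1}),\dots,c(e_{2j}))$. $\pi'_l(G)$, the Thue choice index, is the minimum $k$ such that for every assignment of lists of size at least $k$ to the edges, $G$ has a non-repetitive edge-coloring in which every edge receives a color from its list. -}

module Defs where

open import Data.Fin using (Fin; zero; suc; toℕ; fromℕ<; inject₁; inject≤; _↑ˡ_; _↑ʳ_; combine; remQuot; finToFun; funToFin)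
import Data.Fin as Fin
open import Data.Fin.Properties using (all?; any?; ¬∀⟶∃¬; injective⇒≤; toℕ-injective; toℕ-fromℕ<; toℕ-inject₁; inject≤-injective; toℕ-↑ʳ; finToFun-funToFin; remQuot-combine)
import Data.Fin.Properties as FinP
open import Data.Integer using (ℤ; +_; ∣_∣)
import Data.Integer as ℤ
open import Data.List using (List; length; map; filter; allFin; tabulate; lookup)
open import Data.List.Extrema.Nat using (max)
open import Data.List.Membership.Propositional using (_∈_)
open import Data.List.Membership.Propositional.Properties using (∈-tabulate⁻; ∈-lookup)
open import Data.List.Properties using (length-tabulate)
import Data.List.Relation.Unary.All as All
open import Data.List.Relation.Unary.AllPairs using (_∷_)
open import Data.List.Relation.Unary.Unique.Propositional using (Unique)
open import Data.List.Relation.Unary.Unique.Propositional.Properties using (tabulate⁺)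
open import Data.Nat using (ℕ; zero; suc; _+_; _*_; _^_; _≤_; _<_; z≤n; s≤s)
import Data.Nat.Properties as ℕ
open import Data.Product using (Σ; ∃; ∃₂; ∃-syntax; _×_; _,_; proj₁; proj₂)
open import Data.Sum using (_⊎_; inj₁; inj₂)
open import Function using (_∘_; Injective)
open import Relation.Binary.PropositionalEquality using (_≡_; _≗_; refl; sym; trans; cong; subst)
open import Relation.Nullary using (¬_; Dec; yes; no; contradiction)
open import Relation.Nullary.Decidable using (map′; ¬?; decidable-stable; _⊎-dec_; _×-dec_; _→-dec_)

-- Finite simple graphs.  Each unordered edge is stored once, oriented from its
-- smaller to its larger endpoint, so `src<tgt` excludes loops and `simple`
-- excludes parallel edges.
record Graph : Set where
  field
    order   : ℕ
    size    : ℕ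

  Vertex = Fin order
  Edge   = Fin size

  field
    src tgt : Edge → Vertex
    src<tgt : ∀ e → src e Fin.< tgt e
    simple  : ∀ {e e′} → src e ≡ src e′ → tgt e ≡ tgt e′ → e ≡ e′

  Joins : Edge → Vertex → Vertex → Set
  Joins e u v = (src e ≡ u × tgt e ≡ v) ⊎ (src e ≡ v × tgt e ≡ u)

  Incident : Vertex → Edge → Set
  Incident v e = src e ≡ v ⊎ tgt e ≡ v

  incident? : ∀ v e → Dec (Incident v e)
  incident? v e = (src e FinP.≟ v) ⊎-dec (tgt e FinP.≟ v)

  degree : Vertex → ℕ
  degree v = length (filter (incident? v) (allFin size))

  maxDegree : ℕ
  maxDegree = max 0 (map degree (allFin order))

  record Path (ℓ : ℕ) : Set where
    field
      vertex           : Fin (suc ℓ) → Vertex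
      edge             : Fin ℓ → Edge
      vertex-injective : Injective _≡_ _≡_ vertex
      joins            : ∀ i → Joins (edge i) (vertex (inject₁ i)) (vertex (suc i))

open Graph public using (maxDegree)

module _ (G : Graph) where
  open Graph G

  Coloring : Set
  Coloring = Edge → ℕ

  -- A path without edges is not a repetition, hence 1 ≤ j.
  NonRepetitive : Coloring → Set
  NonRepetitive c = ∀ j → 1 ≤ j → (p : Path (j + j)) →
    ¬ ((λ i → c (Path.edge p (i ↑ˡ j))) ≗ (λ i → c (Path.edge p (j ↑ʳ i))))

  -- Lists are duplicate-free, so that their length is their number of colours.
  NonRepetitivelyChoosable : ℕ → Set
  NonRepetitivelyChoosable k =
    (L : Edge → List ℕ) → (∀ e → Unique (L e)) → (∀ e → k ≤ length (L e)) →
    ∃[ c ] (∀ e → c e ∈ L e) × NonRepetitive c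

  IsThueChoiceIndex : ℕ → Set
  IsThueChoiceIndex k =
    NonRepetitivelyChoosable k × (∀ k′ → NonRepetitivelyChoosable k′ → k ≤ k′)

-- x ≤∛ y says x ≤ y^(1/3) for the real cube root; as cubing is strictly
-- increasing on the reals, no sign condition is needed.
infix 4 _≤∛_
_≤∛_ : ℤ → ℤ → Set
x ≤∛ y = x ℤ.^ 3 ℤ.≤ y

-- f(n) = O(n^(4/3)), i.e. |f(n)| ≤ C n^(4/3) = (C³ n⁴)^(1/3) eventually.  Integer
-- values lose no generality in an upper bound: a real f may be rounded up.
IsO[n^4/3] : (ℕ → ℤ) → Set
IsO[n^4/3] f = ∃₂ λ C N → ∀ n → N ≤ n → + ∣ f n ∣ ≤∛ + (C ^ 3 * n ^ 4)

-- The remainder constructs the Thue choice index as a function of the graph: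
-- choosability is decidable and holds for k = size, so a least k exists.

private
  variable
    a b : ℕ

  -- Injectivity with explicit arguments, which Agda cannot infer below.
  Inj : {A B : Set} → (A → B) → Set
  Inj f = ∀ x y → f x ≡ f y → x ≡ y

  all-fun? : {P : (Fin a → Fin b) → Set} → (∀ {f g} → f ≗ g → P f → P g) →
             (∀ f → Dec (P f)) → Dec (∀ f → P f)
  all-fun? resp P? = map′
    (λ h f → resp (finToFun-funToFin f) (h (funToFin f)))
    (λ h i → h (finToFun i))
    (all? (λ i → P? (finToFun i)))

  any-fun? : {P : (Fin a → Fin b) → Set} → (∀ {f g} → f ≗ g → P f → P g) →
             (∀ f → Dec (P f)) → Dec (∃ P)
  any-fun? resp P? = map′
    (λ (i , h) → finToFun i , h)
    (λ (f , h) → funToFin f , resp (sym ∘ finToFun-funToFin f) h)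
    (any? (λ i → P? (finToFun i)))

  injective? : (f : Fin a → Fin b) → Dec (Inj f)
  injective? f = all? λ x → all? λ y → (f x FinP.≟ f y) →-dec (x FinP.≟ y)

  injective-resp : {A : Set} {f g : Fin a → A} → f ≗ g → Inj f → Inj g
  injective-resp eq inj x y gx≡gy = inj x y (trans (eq x) (trans gx≡gy (sym (eq y))))

  least : {P : ℕ → Set} → (∀ k → Dec (P k)) → ∀ K → P K →
          ∃[ k ] P k × (∀ k′ → P k′ → k ≤ k′)
  least P? K pK with P? 0
  ... | yes p0 = 0 , p0 , λ _ _ → z≤n
  least P? zero    pK | no ¬p0 = contradiction pK ¬p0
  least {P} P? (suc K) pK | no ¬p0 with least (P? ∘ suc) K pK
  ... | k , pk , min = suc k , pk , lower
    where
    lower : ∀ k′ → P k′ → suc k ≤ k′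
    lower zero     p = contradiction p ¬p0
    lower (suc k′) p = s≤s (min k′ p)

  lookup-injective : {A : Set} {xs : List A} → Unique xs → Injective _≡_ _≡_ (lookup xs)
  lookup-injective (_  ∷ _) {zero}  {zero}  _  = refl
  lookup-injective (x∉ ∷ _) {zero}  {suc j} eq = contradiction eq (All.lookup x∉ (∈-lookup j))
  lookup-injective (x∉ ∷ _) {suc i} {zero}  eq = contradiction (sym eq) (All.lookup x∉ (∈-lookup i))
  lookup-injective (_  ∷ u) {suc i} {suc j} eq = cong suc (lookup-injective u eq)

  -- Replace every value of a function by an index at which it is attained.
  module Rename (f : Fin a → ℕ) where
    Attained : ℕ → Set
    Attained v = ∃[ y ] f y ≡ v

    find : ∀ {v} → Dec (Attained v) → Attained v → Attained v
    find (yes p) _ = p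
    find (no ¬p) p = contradiction p ¬p

    find-irrelevant : ∀ {v} (d : Dec (Attained v)) p q → find d p ≡ find d q
    find-irrelevant (yes _) _ _ = refl
    find-irrelevant (no ¬p) p _ = contradiction p ¬p

    attained? : ∀ v → Dec (Attained v)
    attained? v = any? (λ y → f y ℕ.≟ v)

    rename′ : ∀ v → Attained v → Fin a
    rename′ v p = proj₁ (find (attained? v) p)

    rename : Fin a → Fin a
    rename x = rename′ (f x) (x , refl)

    f-rename : ∀ x → f (rename x) ≡ f x
    f-rename x = proj₂ (find (attained? (f x)) (x , refl))

    rename-cong : ∀ {x y} → f x ≡ f y → rename x ≡ rename y
    rename-cong {x} {y} eq = go (f x) eq (x , refl)
      where
      go : ∀ v → v ≡ f y → (p : Attained v) → rename′ v p ≡ rename y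
      go .(f y) refl p = cong proj₁ (find-irrelevant (attained? (f y)) p (y , refl))

  distinctRepresentatives : ∀ t {m} → t ≤ m → (ℓ : Fin t → Fin m → ℕ) →
    (∀ e → Inj (ℓ e)) →
    Σ (Fin t → Fin m) λ s → Inj (λ e → ℓ e (s e))
  distinctRepresentatives zero    _   ℓ inj = (λ ()) , λ ()
  distinctRepresentatives (suc t) {m} t<m ℓ inj
    with s , s-inj ← distinctRepresentatives t (ℕ.<⇒≤ t<m) (λ e → ℓ (suc e)) (λ e → inj (suc e))
    with any? (λ i → all? λ j → ¬? (ℓ zero i ℕ.≟ ℓ (suc j) (s j)))
  ... | yes (i , fresh) = s′ , s′-inj
    where
    s′ : Fin (suc t) → Fin m
    s′ zero    = i
    s′ (suc j) = s j

    s′-inj : Inj (λ e → ℓ e (s′ e))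
    s′-inj zero    zero    _  = refl
    s′-inj zero    (suc j) eq = contradiction eq (fresh j)
    s′-inj (suc j) zero    eq = contradiction (sym eq) (fresh j)
    s′-inj (suc j) (suc k) eq = cong suc (s-inj j k eq)
  ... | no ¬fresh = contradiction (injective⇒≤ clash-injective) (ℕ.<⇒≱ t<m)
    where
    clash : ∀ i → ∃[ j ] ¬ ¬ (ℓ zero i ≡ ℓ (suc j) (s j))
    clash i = ¬∀⟶∃¬ _ _ (λ j → ¬? (ℓ zero i ℕ.≟ ℓ (suc j) (s j))) (λ h → ¬fresh (i , h))

    clash-≡ : ∀ i → ℓ zero i ≡ ℓ (suc (proj₁ (clash i))) (s (proj₁ (clash i)))
    clash-≡ i = decidable-stable (_ ℕ.≟ _) (proj₂ (clash i))

    clash-injective : Injective _≡_ _≡_ (proj₁ ∘ clash)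
    clash-injective {x} {y} eq = inj zero x y
      (trans (clash-≡ x) (trans (cong (λ j → ℓ (suc j) (s j)) eq) (sym (clash-≡ y))))

module _ (G : Graph) where
  open Graph G

  private
    nonRepetitive-resp : ∀ {c d : Coloring G} → (∀ e e′ → d e ≡ d e′ → c e ≡ c e′) →
                         NonRepetitive G c → NonRepetitive G d
    nonRepetitive-resp h nr j 1≤j p rep = nr j 1≤j p (λ i → h _ _ (rep i))

    module _ (c : Coloring G) where
      Repetition : ∀ j → (Fin (suc (j + j)) → Vertex) → (Fin (j + j) → Edge) → Set
      Repetition j v w =
        Inj v ×
        (∀ i → Joins (w i) (v (inject₁ i)) (v (suc i))) ×
        (∀ i → c (w (i ↑ˡ j)) ≡ c (w (j ↑ʳ i)))

      repetition? : ∀ j v w → Dec (Repetition j v w)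
      repetition? j v w =
        injective? v ×-dec
        (all? λ i → ((src (w i) FinP.≟ _) ×-dec (tgt (w i) FinP.≟ _)) ⊎-dec
                    ((src (w i) FinP.≟ _) ×-dec (tgt (w i) FinP.≟ _))) ×-dec
        (all? λ i → c (w (i ↑ˡ j)) ℕ.≟ c (w (j ↑ʳ i)))

      joins-resp : ∀ {e e′ u u′ v v′} → e ≡ e′ → u ≡ u′ → v ≡ v′ → Joins e u v → Joins e′ u′ v′
      joins-resp refl refl refl h = h

      repetition-resp : ∀ j {v v′ w w′} → v ≗ v′ → w ≗ w′ →
                        Repetition j v w → Repetition j v′ w′
      repetition-resp j v≗ w≗ (inj , js , eq) =
        injective-resp v≗ inj ,
        (λ i → joins-resp (w≗ i) (v≗ (inject₁ i)) (v≗ (suc i)) (js i)) ,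
        (λ i → trans (cong c (sym (w≗ _))) (trans (eq i) (cong c (w≗ _))))

      HasRepetition : ℕ → Set
      HasRepetition j = 1 ≤ j × ∃₂ (Repetition j)

      hasRepetition? : ∀ j → Dec (HasRepetition j)
      hasRepetition? j = (1 ℕ.≤? j) ×-dec
        any-fun? (λ v≗ (w , r) → w , repetition-resp j v≗ (λ _ → refl) r)
          (λ v → any-fun? (repetition-resp j (λ _ → refl)) (repetition? j v))

      nonRepetitive? : Dec (NonRepetitive G c)
      nonRepetitive? = map′ to from (all? {n = order} λ j → ¬? (hasRepetition? (toℕ j)))
        where
        to : (∀ (j : Fin order) → ¬ HasRepetition (toℕ j)) → NonRepetitive G c
        to h j 1≤j p rep = h (fromℕ< j<n)
          (subst HasRepetition (sym (toℕ-fromℕ< j<n))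
            (1≤j , vertex , edge , (λ _ _ → vertex-injective) , joins , rep))
          where
          open Path p
          j<n : j < order
          j<n = ℕ.≤-trans (s≤s (ℕ.m≤m+n j j)) (injective⇒≤ vertex-injective)

        from : NonRepetitive G c → ∀ (j : Fin order) → ¬ HasRepetition (toℕ j)
        from nr j (1≤j , v , w , inj , js , rep) = nr (toℕ j) 1≤j
          record { vertex = v ; edge = w ; vertex-injective = inj _ _ ; joins = js } rep

    -- Choosability for lists of k colours taken from a palette of size · k colours.
    module _ (k : ℕ) where
      Palette = Fin (size * k)

      row : (Palette → Palette) → Edge → Fin k → Palette
      row Λ e i = Λ (combine e i)

      Colorable : (Palette → Palette) → Set
      Colorable Λ = Σ (Edge → Fin k) λ s → NonRepetitive G (λ e → toℕ (row Λ e (s e)))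

      PaletteChoosable : Set
      PaletteChoosable = ∀ Λ → (∀ e → Inj (row Λ e)) → Colorable Λ

      paletteChoosable? : Dec PaletteChoosable
      paletteChoosable? = all-fun?
        (λ {f} {g} f≗g h inj →
          let s , nr = h (λ e → injective-resp (λ i → sym (f≗g (combine e i))) (inj e)) in
          s , nonRepetitive-resp (λ e e′ eq → cong toℕ
                (trans (f≗g (combine e (s e)))
                  (trans (toℕ-injective eq) (sym (f≗g (combine e′ (s e′))))))) nr)
        (λ Λ → all? (λ e → injective? (row Λ e)) →-dec
          any-fun?
            (λ {s} {s′} s≗ → nonRepetitive-resp (λ e e′ eq →
              trans (cong (toℕ ∘ row Λ e) (s≗ e))
                (trans eq (sym (cong (toℕ ∘ row Λ e′) (s≗ e′))))))
            (λ s → nonRepetitive? (λ e → toℕ (row Λ e (s e)))))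

      toPalette : NonRepetitivelyChoosable G k → PaletteChoosable
      toPalette ch Λ inj = s , nonRepetitive-resp
          (λ e e′ eq → trans (s-≡ e) (trans eq (sym (s-≡ e′)))) (proj₂ (proj₂ chosen))
        where
        L : Edge → List ℕ
        L e = tabulate (toℕ ∘ row Λ e)

        chosen = ch L (λ e → tabulate⁺ (λ eq → inj e _ _ (toℕ-injective eq)))
                      (λ e → ℕ.≤-reflexive (sym (length-tabulate (toℕ ∘ row Λ e))))

        position : ∀ e → ∃[ i ] proj₁ chosen e ≡ toℕ (row Λ e i)
        position e = ∈-tabulate⁻ (proj₁ (proj₂ chosen) e)

        s : Edge → Fin k
        s e = proj₁ (position e)

        s-≡ : ∀ e → proj₁ chosen e ≡ toℕ (row Λ e (s e))
        s-≡ e = proj₂ (position e)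

      fromPalette : PaletteChoosable → NonRepetitivelyChoosable G k
      fromPalette ch L uniq long =
        (λ e → ℓ e (s e)) , (λ e → ∈-lookup (inject≤ (s e) (long e))) ,
        nonRepetitive-resp (λ e e′ eq → cong toℕ
          (rename-cong (trans (flat-combine e (s e)) (trans eq (sym (flat-combine e′ (s e′))))))) nr
        where
        ℓ : Edge → Fin k → ℕ
        ℓ e i = lookup (L e) (inject≤ i (long e))

        flat : Palette → ℕ
        flat x = let e , i = remQuot {size} k x in ℓ e i

        flat-combine : ∀ e i → flat (combine e i) ≡ ℓ e i
        flat-combine e i = cong (λ (e′ , i′) → ℓ e′ i′) (remQuot-combine e i)

        open Rename flat

        row-injective : ∀ e → Inj (row rename e)
        row-injective e x y eq =
          inject≤-injective _ _ x y (lookup-injective (uniq e)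
            (trans (sym (flat-combine e x)) (trans (sym (f-rename (combine e x)))
              (trans (cong flat eq) (trans (f-rename (combine e y)) (flat-combine e y))))))

        result = ch rename row-injective
        s  = proj₁ result
        nr = proj₂ result

      choosable? : Dec (NonRepetitivelyChoosable G k)
      choosable? = map′ fromPalette toPalette paletteChoosable?

    edge-injective : ∀ {ℓ} (p : Path ℓ) → Injective _≡_ _≡_ (Path.edge p)
    edge-injective p {x} {y} eq =
      toℕ-injective (go (subst (λ e → Joins e _ _) eq (joins x)) (joins y))
      where
      open Path p
      V = vertex-injective

      straight : vertex (suc x) ≡ vertex (suc y) → toℕ x ≡ toℕ y
      straight q = ℕ.suc-injective (cong toℕ (V q))

      crossed : vertex (inject₁ x) ≡ vertex (suc y) → vertex (suc x) ≡ vertex (inject₁ y) →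
                toℕ x ≡ toℕ y
      crossed q r = contradiction (ℕ.≤-reflexive y<x) (ℕ.<-asym (ℕ.≤-reflexive x<y))
        where
        x<y : suc (toℕ x) ≡ toℕ y
        x<y = trans (cong toℕ (V r)) (toℕ-inject₁ y)

        y<x : suc (toℕ y) ≡ toℕ x
        y<x = trans (sym (cong toℕ (V q))) (toℕ-inject₁ x)

      go : Joins (edge y) (vertex (inject₁ x)) (vertex (suc x)) →
           Joins (edge y) (vertex (inject₁ y)) (vertex (suc y)) → toℕ x ≡ toℕ y
      go (inj₁ (_ , q)) (inj₁ (_ , r)) = straight (trans (sym q) r)
      go (inj₁ (q , r)) (inj₂ (q′ , r′)) = crossed (trans (sym q) q′) (trans (sym r) r′)
      go (inj₂ (q , r)) (inj₁ (q′ , r′)) = crossed (trans (sym r) r′) (trans (sym q) q′)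
      go (inj₂ (q , _)) (inj₂ (r , _)) = straight (trans (sym q) r)

    injective⇒nonRepetitive : ∀ {c : Coloring G} → Injective _≡_ _≡_ c → NonRepetitive G c
    injective⇒nonRepetitive inj (suc j) _ p rep
      with () ← trans (cong toℕ (edge-injective p (inj (rep zero)))) (toℕ-↑ʳ (suc j) (zero {j}))

    choosable-size : NonRepetitivelyChoosable G size
    choosable-size L uniq long =
      let s , s-inj = distinctRepresentatives size ℕ.≤-refl
            (λ e i → lookup (L e) (inject≤ i (long e)))
            (λ e x y eq → inject≤-injective _ _ x y (lookup-injective (uniq e) eq))
      in (λ e → lookup (L e) (inject≤ (s e) (long e))) ,
         (λ e → ∈-lookup (inject≤ (s e) (long e))) ,
         injective⇒nonRepetitive (s-inj _ _)

  abstract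
    thueChoiceIndex : ∃ (IsThueChoiceIndex G)
    thueChoiceIndex = least choosable? size choosable-size

  π′ₗ : ℕ
  π′ₗ = proj₁ thueChoiceIndex

{-# OPTIONS --safe #-}
module Submission where

-- Counting in the style of Rosenfeld.  For a set S of edges let N S be the number
-- of choices of one colour index per edge (from all edges, of k each) without a
-- repetition inside S.  By induction on S, β N (S − e) ≤ k N S, where k = β + s:
-- a choice that is lost when e is put back has a repetition on a path of
-- 2 (j + 1) edges through e.  There are at most 2 (j + 1) Δ^(2j+1) such paths with
-- e in the first half, up to reversal, and the half with e is determined by the
-- rest, so each path costs at most N (S − e) / (k β^j) choices.  The resulting
-- series 2Δ Σ (j + 1) (Δ² / β)^j = 2Δ β² / (β − Δ²)² has to be at most s.

open import Defs
open import Data.Nat using (ℕ; _*_; _^_; _≤_)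
open import Data.Integer using (ℤ; +_; _-_)
open import Data.Product using (∃-syntax; _×_)

import Algebra.Properties.Semiring.Sum as SemiringSum
open import Data.Fin using (Fin; zero; suc; toℕ; fromℕ; inject₁; inject≤; _↑ˡ_; _↑ʳ_)
import Data.Fin.Properties as Fin
open import Data.Fin.Subset using (Subset; ⁅_⁆; ∣_∣; ⊤)
  renaming (_∈_ to _∈ˢ_; _∉_ to _∉ˢ_; _-_ to _-ˢ_)
import Data.Fin.Subset.Properties as Subset
open import Data.Integer as ℤ using (-[1+_])
import Data.Integer.Properties as ℤ
open import Data.List as List using
  (List; []; _∷_; _++_; [_]; length; map; take; drop; reverse; filter; concatMap; upTo; tabulate; allFin)
open import Data.List.Extrema.Nat using (xs≤max)
import Data.List.Membership.DecPropositional as DecMembership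
open import Data.List.Membership.Propositional using (_∈_; _∉_; lose; find)
open import Data.List.Membership.Propositional.Properties using
  (∈-∃++; ∈-filter⁺; ∈-filter⁻; ∈-++⁺ˡ; ∈-++⁺ʳ; ∈-++⁻; ∈-allFin; ∈-concatMap⁺; ∈-concatMap⁻;
   ∈-map⁺; ∈-map⁻; ∈-upTo⁺; ∈-upTo⁻; ∈-lookup)
import Data.List.Properties as List
open import Data.List.Relation.Binary.Permutation.Propositional using (↭-sym; ↭⇒↭ₛ)
open import Data.List.Relation.Binary.Permutation.Propositional.Properties using (↭-reverse)
import Data.List.Relation.Binary.Permutation.Setoid.Properties as Permutation
open import Data.List.Relation.Unary.All as All using (All; []; _∷_)
import Data.List.Relation.Unary.All.Properties as All
open import Data.List.Relation.Unary.AllPairs using ([]; _∷_)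
open import Data.List.Relation.Unary.Any as Any using (Any; here; there)
import Data.List.Relation.Unary.Unique.DecPropositional as DecUnique
open import Data.List.Relation.Unary.Unique.Propositional using (Unique)
import Data.List.Relation.Unary.Unique.Propositional.Properties as Unique
open import Data.Nat using (zero; suc; _+_; _∸_; _<_; z≤n; s≤s; NonZero; >-nonZero; >-nonZero⁻¹)
import Data.Nat.Properties as ℕ
open import Data.Nat.Tactic.RingSolver using (solve-∀)
open import Data.Product using (∃; ∃₂; _,_; proj₁; proj₂)
open import Data.Sum as Sum using (_⊎_; inj₁; inj₂)
open import Data.Vec as Vec using (Vec; []; _∷_; _[_]≔_)
import Data.Vec.Properties as Vec
open import Function using (_∘_; Injective)
open import Relation.Binary.PropositionalEquality hiding ([_])
open import Relation.Nullary using (¬_; Dec; yes; no; contradiction; ¬?)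
open import Relation.Nullary.Decidable using (_×-dec_)
open SemiringSum ℕ.+-*-semiring using (sum; ∑-distrib-+; *-distribˡ-sum; sum-cong-≗)

-- Each `N S` counts full choices, with the entries outside `S` free, so all these counts live in
-- one product space and every estimate is an inequality between totals with the divisions cleared.
-- The squares avoided are those on trails, that is, walks with distinct edges, and not only those
-- on paths: walks are counted by powers of Δ, and distinct edges already make the two halves
-- disjoint. With t = β - Δ², the series asks for s of about 2Δ⁵ / t². The minimum of t + 2Δ⁵ / t²
-- is 3 / 2^(1/3) · Δ^(5/3), about 2.38 Δ^(5/3). This leaves room below 2^(4/3), about 2.52, for
-- convenient coefficients. Taking Δ⁴ for β² changes s by a relative error of order t / Δ², that is
-- Δ^(-1/3), hence by O(Δ^(4/3)). Rounding the cube root of Δ costs the same order.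

private variable
  κ m n : ℕ
  A B P Q : Set

-- Finite sums and counting

∑ᴸ : List A → (A → ℕ) → ℕ
∑ᴸ []       f = 0
∑ᴸ (x ∷ xs) f = f x + ∑ᴸ xs f

∑< : ℕ → (ℕ → ℕ) → ℕ
∑< zero    f = 0
∑< (suc n) f = ∑< n f + f n

∈⇒≤∑ᴸ : ∀ {x : A} {xs} (f : A → ℕ) → x ∈ xs → f x ≤ ∑ᴸ xs f
∈⇒≤∑ᴸ f (here refl) = ℕ.m≤m+n _ _
∈⇒≤∑ᴸ f (there x∈)  = ℕ.≤-trans (∈⇒≤∑ᴸ f x∈) (ℕ.m≤n+m _ _)

<⇒≤∑< : ∀ {i n} (f : ℕ → ℕ) → i < n → f i ≤ ∑< n f
<⇒≤∑< {n = suc n} f (s≤s i≤n) with ℕ.m≤n⇒m<n∨m≡n i≤n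
... | inj₁ i<n  = ℕ.≤-trans (<⇒≤∑< f i<n) (ℕ.m≤m+n _ _)
... | inj₂ refl = ℕ.m≤n+m _ _

∑<-cong : ∀ n {f g : ℕ → ℕ} → (∀ i → f i ≡ g i) → ∑< n f ≡ ∑< n g
∑<-cong zero    f≗g = refl
∑<-cong (suc n) f≗g = cong₂ _+_ (∑<-cong n f≗g) (f≗g n)

∑ᴸ-bound : ∀ {c B} (xs : List A) (f : A → ℕ) → (∀ {x} → x ∈ xs → c * f x ≤ B) →
           c * ∑ᴸ xs f ≤ length xs * B
∑ᴸ-bound {c = c} []       f bound = ℕ.≤-reflexive (ℕ.*-zeroʳ c)
∑ᴸ-bound {c = c} (x ∷ xs) f bound = ℕ.≤-trans
  (ℕ.≤-reflexive (ℕ.*-distribˡ-+ c (f x) (∑ᴸ xs f)))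
  (ℕ.+-mono-≤ (bound (here refl)) (∑ᴸ-bound {c = c} xs f (bound ∘ there)))

∑<-*ˡ : ∀ c n f → c * ∑< n f ≡ ∑< n (λ i → c * f i)
∑<-*ˡ c zero    f = ℕ.*-zeroʳ c
∑<-*ˡ c (suc n) f = trans (ℕ.*-distribˡ-+ c _ _) (cong (_+ c * f n) (∑<-*ˡ c n f))

sum-mono : {f g : Fin n → ℕ} → (∀ i → f i ≤ g i) → sum f ≤ sum g
sum-mono {zero}  f≤g = z≤n
sum-mono {suc n} f≤g = ℕ.+-mono-≤ (f≤g zero) (sum-mono (f≤g ∘ suc))

sum-const : ∀ n c → sum {n} (λ _ → c) ≡ n * c
sum-const zero    c = refl
sum-const (suc n) c = cong (_+_ c) (sum-const n c)

𝟙 : Dec P → ℕ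
𝟙 (yes _) = 1
𝟙 (no  _) = 0

𝟙-mono : (P? : Dec P) (Q? : Dec Q) → (P → Q) → 𝟙 P? ≤ 𝟙 Q?
𝟙-mono (yes p) (yes q) h = ℕ.≤-refl
𝟙-mono (yes p) (no ¬q) h = contradiction (h p) ¬q
𝟙-mono (no ¬p) Q?      h = z≤n

𝟙-≤ : ∀ {n} (P? : Dec P) → (P → 1 ≤ n) → 𝟙 P? ≤ n
𝟙-≤ (yes p) h = h p
𝟙-≤ (no _)  h = z≤n

𝟙-positive : (P? : Dec P) → 0 < 𝟙 P? → P
𝟙-positive (yes p) _ = p

𝟙-true : (P? : Dec P) → P → 𝟙 P? ≡ 1
𝟙-true (yes _) p = refl
𝟙-true (no ¬p) p = contradiction p ¬p

sum-𝟙-≤ : {R : Fin n → Set} (R? : ∀ i → Dec (R i)) (P? : Dec P) →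
          (∀ i → R i → P) → (∀ i j → R i → R j → i ≡ j) →
          sum (λ i → 𝟙 (R? i)) ≤ 𝟙 P?
sum-𝟙-≤ {zero}  R? P? R⇒P unique = z≤n
sum-𝟙-≤ {suc n} {R = R} R? P? R⇒P unique with R? zero
... | no  _  = sum-𝟙-≤ (R? ∘ suc) P? (R⇒P ∘ suc)
                 (λ i j r r′ → Fin.suc-injective (unique (suc i) (suc j) r r′))
... | yes r₀ = begin
    1 + sum (λ i → 𝟙 (R? (suc i)))  ≤⟨ ℕ.+-monoʳ-≤ 1 (sum-mono none) ⟩
    1 + sum {n} (λ _ → 0)           ≡⟨ cong suc (trans (sum-const n 0) (ℕ.*-zeroʳ n)) ⟩
    1                               ≡⟨ 𝟙-true P? (R⇒P zero r₀) ⟨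
    𝟙 P?                            ∎
  where
  open ℕ.≤-Reasoning
  none : ∀ i → 𝟙 (R? (suc i)) ≤ 0
  none i with R? (suc i)
  ... | yes r with () ← unique zero (suc i) r₀ r
  ... | no  _ = z≤n

-- Sums over all vectors, and resampling one entry

total : (Vec (Fin κ) m → ℕ) → ℕ
total {m = zero}  F = F []
total {m = suc m} F = sum λ i → total (λ v → F (i ∷ v))

total-mono : {F G : Vec (Fin κ) m → ℕ} → (∀ v → F v ≤ G v) → total F ≤ total G
total-mono {m = zero}  F≤G = F≤G []
total-mono {m = suc m} F≤G = sum-mono λ i → total-mono (λ v → F≤G (i ∷ v))

total-+ : (F G : Vec (Fin κ) m → ℕ) → total (λ v → F v + G v) ≡ total F + total G
total-+ {m = zero}  F G = refl
total-+ {m = suc m} F G = trans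
  (sum-cong-≗ (λ i → total-+ (λ v → F (i ∷ v)) (λ v → G (i ∷ v))))
  (∑-distrib-+ (λ i → total (λ v → F (i ∷ v))) _)

total-const : ∀ κ m c → total {κ} {m} (λ _ → c) ≡ κ ^ m * c
total-const κ zero    c = sym (ℕ.*-identityˡ c)
total-const κ (suc m) c = begin
  sum {κ} (λ _ → total {κ} {m} (λ _ → c))  ≡⟨ sum-const κ _ ⟩
  κ * total {κ} {m} (λ _ → c)              ≡⟨ cong (κ *_) (total-const κ m c) ⟩
  κ * (κ ^ m * c)                          ≡⟨ ℕ.*-assoc κ _ c ⟨
  κ ^ suc m * c                            ∎
  where open ≡-Reasoning

total-0 : ∀ κ m → total {κ} {m} (λ _ → 0) ≡ 0
total-0 κ m = trans (total-const κ m 0) (ℕ.*-zeroʳ (κ ^ m))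

total-sum : (G : Fin n → Vec (Fin κ) m → ℕ) →
            total (λ v → sum λ i → G i v) ≡ sum (λ i → total (G i))
total-sum {zero}  {κ} {m} G = total-0 κ m
total-sum {suc n} G = trans (total-+ (G zero) _) (cong (_+_ (total (G zero))) (total-sum (G ∘ suc)))

total-∑ᴸ : (xs : List A) (G : A → Vec (Fin κ) m → ℕ) →
           total (λ v → ∑ᴸ xs λ x → G x v) ≡ ∑ᴸ xs (λ x → total (G x))
total-∑ᴸ {κ = κ} {m} []       G = total-0 κ m
total-∑ᴸ             (x ∷ xs) G = trans (total-+ (G x) _) (cong (_+_ (total (G x))) (total-∑ᴸ xs G))

total-∑< : ∀ n (G : ℕ → Vec (Fin κ) m → ℕ) →
           total (λ v → ∑< n λ i → G i v) ≡ ∑< n (λ i → total (G i))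
total-∑< {κ} {m} zero    G = total-0 κ m
total-∑<         (suc n) G = trans (total-+ _ (G n)) (cong (_+ total (G n)) (total-∑< n G))

-- A given vector equals `v [ a ]≔ i` for exactly κ pairs `(v , i)`: `i` is forced and only the old
-- entry of `v` at `a` is free.
total-resample : ∀ (a : Fin m) (F : Vec (Fin κ) m → ℕ) →
                 total (λ v → sum λ i → F (v [ a ]≔ i)) ≡ κ * total F
total-resample {suc m} {κ} zero F = begin
  sum {κ} (λ _ → total λ v → sum λ i → F (i ∷ v))  ≡⟨ sum-const κ _ ⟩
  κ * total (λ v → sum λ i → F (i ∷ v))          ≡⟨ cong (κ *_) (total-sum (λ i v → F (i ∷ v))) ⟩
  κ * total F                                    ∎
  where open ≡-Reasoning
total-resample {suc m} {κ} (suc a) F = trans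
  (sum-cong-≗ (λ i → total-resample a (λ v → F (i ∷ v))))
  (sym (*-distribˡ-sum κ (λ i → total (λ v → F (i ∷ v)))))

total-positive⇒∃ : (F : Vec (Fin κ) m → ℕ) → 0 < total F → ∃[ v ] 0 < F v
total-positive⇒∃ {m = zero}  F 0<F = [] , 0<F
total-positive⇒∃ {m = suc m} F 0<F =
  let i , 0<Fᵢ = sum-positive⇒∃ _ 0<F ; v , 0<Fv = total-positive⇒∃ _ 0<Fᵢ in i ∷ v , 0<Fv
  where
  sum-positive⇒∃ : ∀ {n} (f : Fin n → ℕ) → 0 < sum f → ∃[ i ] 0 < f i
  sum-positive⇒∃ {suc n} f 0<s with f zero in eq
  ... | suc _ = zero , subst (0 <_) (sym eq) (s≤s z≤n)
  ... | zero  = let i , p = sum-positive⇒∃ (f ∘ suc) 0<s in suc i , p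

count : {P : Vec (Fin κ) m → Set} → (∀ v → Dec (P v)) → ℕ
count P? = total (λ v → 𝟙 (P? v))

count-mono : {P Q : Vec (Fin κ) m → Set} (P? : ∀ v → Dec (P v)) (Q? : ∀ v → Dec (Q v)) →
             (∀ v → P v → Q v) → count P? ≤ count Q?
count-mono P? Q? P⇒Q = total-mono λ v → 𝟙-mono (P? v) (Q? v) (P⇒Q v)

-- If P does not depend on the entry at a, while Q determines it, then Q has
-- conditional probability at most 1/κ given P.
count-resample : {P Q : Vec (Fin κ) m → Set} (P? : ∀ v → Dec (P v)) (Q? : ∀ v → Dec (Q v))
                 (a : Fin m) → (∀ v i → Q (v [ a ]≔ i) → P v) →
                 (∀ v i j → Q (v [ a ]≔ i) → Q (v [ a ]≔ j) → i ≡ j) →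
                 κ * count Q? ≤ count P?
count-resample {κ} P? Q? a Q⇒P determined = begin
  κ * count Q?                                    ≡⟨ total-resample a _ ⟨
  total (λ v → sum λ i → 𝟙 (Q? (v [ a ]≔ i)))
    ≤⟨ total-mono (λ v → sum-𝟙-≤ (λ i → Q? (v [ a ]≔ i)) (P? v) (Q⇒P v) (determined v)) ⟩
  count P?                                        ∎
  where open ℕ.≤-Reasoning

-- With x = q / (q + t), the potential x^n ((n+1)t + q) (q+t) / t² is the tail
-- Σ_{j≥n} (j+1) x^j of the series, so it drops by (n+1) x^n in each step.
arithmetico-geometric : ∀ q t Z (B : ℕ → ℕ) → (∀ j → (q + t) ^ j * B j ≤ suc j * q ^ j * Z) → ∀ n →
  (t * t * ∑< n B) * (q + t) ^ n + q ^ n * (q + t) * (suc n * t + q) * Z ≤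
  (q + t) ^ n * ((q + t) * (q + t) * Z)
arithmetico-geometric q t Z B bound zero = ℕ.≤-reflexive (base q t Z)
  where
  base : ∀ q t Z → (t * t * 0) * 1 + 1 * (q + t) * (1 * t + q) * Z ≡ 1 * ((q + t) * (q + t) * Z)
  base = solve-∀
arithmetico-geometric q t Z B bound (suc n) = begin
  (t * t * (S + B n)) * (β * β ^ n) + q * q ^ n * β * (suc (suc n) * t + q) * Z
    ≡⟨ expand t β q n Z S (B n) (β ^ n) (q ^ n) ⟩
  (t * t * S) * β ^ n * β + t * t * β * (β ^ n * B n) + q * q ^ n * β * (suc (suc n) * t + q) * Z
    ≤⟨ ℕ.+-monoˡ-≤ (q * q ^ n * β * (suc (suc n) * t + q) * Z)
         (ℕ.+-monoʳ-≤ (t * t * S * β ^ n * β) (ℕ.*-monoʳ-≤ (t * t * β) (bound n))) ⟩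
  (t * t * S) * β ^ n * β + t * t * β * (suc n * q ^ n * Z) + q * q ^ n * β * (suc (suc n) * t + q) * Z
    ≡⟨ collect t q n Z S (β ^ n) (q ^ n) ⟩
  ((t * t * S) * β ^ n + q ^ n * β * (suc n * t + q) * Z) * β
    ≤⟨ ℕ.*-monoˡ-≤ β (arithmetico-geometric q t Z B bound n) ⟩
  β ^ n * (β * β * Z) * β
    ≡⟨ final β Z (β ^ n) ⟩
  β * β ^ n * (β * β * Z) ∎
  where
  open ℕ.≤-Reasoning
  β = q + t
  S = ∑< n B
  expand : ∀ t β q n Z S b βⁿ qⁿ →
    (t * t * (S + b)) * (β * βⁿ) + q * qⁿ * β * (suc (suc n) * t + q) * Z ≡
    (t * t * S) * βⁿ * β + t * t * β * (βⁿ * b) + q * qⁿ * β * (suc (suc n) * t + q) * Z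
  expand = solve-∀
  collect : ∀ t q n Z S βⁿ qⁿ →
    (t * t * S) * βⁿ * (q + t) + t * t * (q + t) * (suc n * qⁿ * Z) + q * qⁿ * (q + t) * (suc (suc n) * t + q) * Z ≡
    ((t * t * S) * βⁿ + qⁿ * (q + t) * (suc n * t + q) * Z) * (q + t)
  collect = solve-∀
  final : ∀ β Z βⁿ → βⁿ * (β * β * Z) * β ≡ β * βⁿ * (β * β * Z)
  final = solve-∀

-- Lists and subsets

take-++-length : ∀ (xs ys : List A) {n} → length xs ≡ n → take n (xs ++ ys) ≡ xs
take-++-length []       ys refl = refl
take-++-length (x ∷ xs) ys refl = cong (x ∷_) (take-++-length xs ys refl)

drop-++-length : ∀ (xs ys : List A) {n} → length xs ≡ n → drop n (xs ++ ys) ≡ ys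
drop-++-length []       ys refl = refl
drop-++-length (x ∷ xs) ys refl = drop-++-length xs ys refl

length-take-+ : ∀ m {n} (xs : List A) → length xs ≡ m + n → length (take m xs) ≡ m
length-take-+ zero    xs       _  = refl
length-take-+ (suc m) (x ∷ xs) eq = cong suc (length-take-+ m xs (ℕ.suc-injective eq))

length-drop-+ : ∀ m {n} (xs : List A) → length xs ≡ m + n → length (drop m xs) ≡ n
length-drop-+ zero    xs       eq = eq
length-drop-+ (suc m) (x ∷ xs) eq = length-drop-+ m xs (ℕ.suc-injective eq)

Unique-++⇒∉ : ∀ {xs ys : List A} → Unique (xs ++ ys) → ∀ {x} → x ∈ xs → x ∉ ys
Unique-++⇒∉ {xs = x ∷ xs} (x∉ ∷ _) (here refl) x∈ys = All.lookup x∉ (∈-++⁺ʳ xs x∈ys) refl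
Unique-++⇒∉ {xs = x ∷ xs} (_ ∷ u)  (there x∈)  x∈ys = Unique-++⇒∉ u x∈ x∈ys

Unique-++⇒ˡ : ∀ {xs ys : List A} → Unique (xs ++ ys) → Unique xs
Unique-++⇒ˡ {xs = []}     _        = []
Unique-++⇒ˡ {xs = x ∷ xs} (x∉ ∷ u) = All.++⁻ˡ xs x∉ ∷ Unique-++⇒ˡ u

Unique-reverse : ∀ {xs : List A} → Unique xs → Unique (reverse xs)
Unique-reverse {A} {xs} = Permutation.Unique-resp-↭ (setoid A) (↭⇒↭ₛ (↭-sym (↭-reverse xs)))

module _ {m : ℕ} where

  -- Removing `x` twice is the same as removing it once, whereas removing a member would lower the
  -- cardinality.
  x∉p-x : ∀ (p : Subset m) x → x ∉ˢ p -ˢ x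
  x∉p-x p x x∈ = ℕ.<-irrefl (cong ∣_∣ (Subset.p─q─q≡p─q p ⁅ x ⁆)) (Subset.x∈p⇒∣p-x∣<∣p∣ x∈)

  infixl 5 _∖_
  _∖_ : Subset m → List (Fin m) → Subset m
  p ∖ []       = p
  p ∖ (x ∷ xs) = (p -ˢ x) ∖ xs

  ∖-⊆ : ∀ p xs {x} → x ∈ˢ p ∖ xs → x ∈ˢ p
  ∖-⊆ p []       x∈ = x∈
  ∖-⊆ p (y ∷ xs) x∈ = Subset.p─q⊆p p ⁅ y ⁆ (∖-⊆ (p -ˢ y) xs x∈)

  ∈⇒∉∖ : ∀ p xs {x} → x ∈ xs → x ∉ˢ p ∖ xs
  ∈⇒∉∖ p (x ∷ xs) (here refl) x∈p = x∉p-x p x (∖-⊆ (p -ˢ x) xs x∈p)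
  ∈⇒∉∖ p (y ∷ xs) (there x∈)  x∈p = ∈⇒∉∖ (p -ˢ y) xs x∈ x∈p

-- Rosenfeld's counting argument

-- Colourings of m elements from lists of k = q + t + s colours, avoiding a
-- family of squares of periods up to M.  The sequences in `through e j` represent, up to reversal,
-- the squares of period j + 1 that meet e, with e in the first half.
module Rosenfeld
  (m M q t s z : ℕ) .{{_ : NonZero t}}
  (colour : Fin m → Fin (q + t + s) → ℕ)
  (colour-injective : ∀ e → Injective _≡_ _≡_ (colour e))
  (squares : ℕ → List (List (Fin m)))
  (squares-length : ∀ {n es} → es ∈ squares n → length es ≡ n + n)
  (through : Fin m → ℕ → List (List (Fin m)))
  (through-count : ∀ e j → length (through e j) ≤ suc j * q ^ j * z)
  (through-cover : ∀ {j es e} → es ∈ squares (suc j) → e ∈ es →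
     (es ∈ through e j × e ∈ take (suc j) es) ⊎
     (reverse es ∈ through e j × e ∈ take (suc j) (reverse es)))
  (balance : z * ((q + t) * (q + t)) ≤ s * (t * t))
  where

  private
    β = q + t
    k = β + s

    instance
      β≢0 : NonZero β
      β≢0 = >-nonZero (ℕ.≤-trans (>-nonZero⁻¹ t) (ℕ.m≤n+m t q))

      k≢0 : NonZero k
      k≢0 = >-nonZero (ℕ.≤-trans (>-nonZero⁻¹ β) (ℕ.m≤m+n β s))

  Choice : Set
  Choice = Vec (Fin k) m

  infix 9 _at_
  _at_ : Choice → Fin m → ℕ
  v at e = colour e (Vec.lookup v e)

  at-update : ∀ v a i {e} → e ≢ a → (v [ a ]≔ i) at e ≡ v at e
  at-update v a i {e} e≢a = cong (colour e) (Vec.lookup∘update′ e≢a v i)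

  map-at-update : ∀ v a i {es} → a ∉ es → map ((v [ a ]≔ i) at_) es ≡ map (v at_) es
  map-at-update v a i {es} a∉ = List.map-cong-local
    (All.tabulate λ e∈ → at-update v a i λ { refl → a∉ e∈ })

  IsSquare : ℕ → Choice → List (Fin m) → Set
  IsSquare n v es = map (v at_) (take n es) ≡ map (v at_) (drop n es)

  isSquare? : ∀ n v es → Dec (IsSquare n v es)
  isSquare? n v es = List.≡-dec ℕ._≟_ _ _

  open DecMembership (Fin._≟_ {m}) using (_∈?_)
  open DecUnique (Fin._≟_ {m}) using (unique?)

  SquareIn : Subset m → ℕ → Choice → List (Fin m) → Set
  SquareIn S n v es = Unique es × All (_∈ˢ S) es × IsSquare n v es

  HasSquare : Subset m → Choice → Set
  HasSquare S v = ∃[ j ] j < M × Any (SquareIn S (suc j) v) (squares (suc j))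

  hasSquare? : ∀ S v → Dec (HasSquare S v)
  hasSquare? S v = ℕ.anyUpTo? (λ j → Any.any? (λ es →
    unique? es ×-dec All.all? (Subset._∈? S) es ×-dec isSquare? (suc j) v es) _) M

  hasSquare-⊆ : ∀ {S T} v → (∀ {x} → x ∈ˢ S → x ∈ˢ T) → HasSquare S v → HasSquare T v
  hasSquare-⊆ v S⊆T (j , j<M , any) =
    j , j<M , Any.map (λ (u , ⊆S , sq) → u , All.map S⊆T ⊆S , sq) any

  hasSquare-update : ∀ {S a} v i → a ∉ˢ S → HasSquare S v → HasSquare S (v [ a ]≔ i)
  hasSquare-update {S} {a} v i a∉S (j , j<M , any) = j , j<M , Any.map step any
    where
    step : ∀ {es} → SquareIn S (suc j) v es → SquareIn S (suc j) (v [ a ]≔ i) es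
    step {es} (u , ⊆S , sq) = u , ⊆S ,
      trans (map-at-update v a i (a∉ ∘ ∈take)) (trans sq (sym (map-at-update v a i (a∉ ∘ ∈drop))))
      where
      a∉ : a ∉ es
      a∉ a∈ = a∉S (All.lookup ⊆S a∈)
      split = List.take++drop≡id (suc j) es
      ∈take : ∀ {x} → x ∈ take (suc j) es → x ∈ es
      ∈take x∈ = subst (_ ∈_) split (∈-++⁺ˡ x∈)
      ∈drop : ∀ {x} → x ∈ drop (suc j) es → x ∈ es
      ∈drop x∈ = subst (_ ∈_) split (∈-++⁺ʳ _ x∈)

  avoids? : ∀ S v → Dec (¬ HasSquare S v)
  avoids? S v = ¬? (hasSquare? S v)

  N : Subset m → ℕ
  N S = count (avoids? S)

  Matching : Subset m → List (Fin m) → List (Fin m) → Choice → Set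
  Matching S as bs v = ¬ HasSquare S v × map (v at_) as ≡ map (v at_) bs

  matching? : ∀ S as bs v → Dec (Matching S as bs v)
  matching? S as bs v = avoids? S v ×-dec List.≡-dec ℕ._≟_ (map (v at_) as) (map (v at_) bs)

  -- The head `a` occurs neither in `S` nor in the rest of `as` and `bs`. Its entry is therefore
  -- independent of the remaining conditions, while the colour of `b` allows it at most one index.
  -- So `count-resample` gains a factor k for each element of `as`.
  count-matching : ∀ S as bs → length as ≡ length bs → Unique as →
    (∀ {a} → a ∈ as → a ∉ bs) → (∀ {a} → a ∈ as → a ∉ˢ S) →
    k ^ length as * count (matching? S as bs) ≤ N S
  count-matching S [] [] _ _ _ _ = ℕ.≤-trans (ℕ.≤-reflexive (ℕ.*-identityˡ _))
    (count-mono (matching? S [] []) (avoids? S) λ _ → proj₁)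
  count-matching S (a ∷ as) (b ∷ bs) len (a∉as ∷ u) disjoint ∉S = begin
    k * k ^ length as * count Q?    ≡⟨ rotate k (k ^ length as) (count Q?) ⟩
    k ^ length as * (k * count Q?)
      ≤⟨ ℕ.*-monoʳ-≤ (k ^ length as) (count-resample P? Q? a Q⇒P determined) ⟩
    k ^ length as * count P?
      ≤⟨ count-matching S as bs (ℕ.suc-injective len) u (λ x∈ → disjoint (there x∈) ∘ there) (∉S ∘ there) ⟩
    N S                             ∎
    where
    open ℕ.≤-Reasoning
    P? = matching? S as bs
    Q? = matching? S (a ∷ as) (b ∷ bs)

    rotate : ∀ x y c → x * y * c ≡ y * (x * c)
    rotate = solve-∀

    a∉as′ : a ∉ as
    a∉as′ a∈ = All.lookup a∉as a∈ refl

    Q⇒P : ∀ v i → Matching S (a ∷ as) (b ∷ bs) (v [ a ]≔ i) → Matching S as bs v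
    Q⇒P v i (av , eq) = av ∘ hasSquare-update v i (∉S (here refl)) ,
      trans (sym (map-at-update v a i a∉as′)) (trans (List.∷-injectiveʳ eq)
        (map-at-update v a i (disjoint (here refl) ∘ there)))

    value : ∀ v i → Matching S (a ∷ as) (b ∷ bs) (v [ a ]≔ i) → colour a i ≡ v at b
    value v i (_ , eq) = trans (cong (colour a) (sym (Vec.lookup∘update a v i)))
      (trans (List.∷-injectiveˡ eq) (at-update v a i λ { refl → disjoint (here refl) (here refl) }))

    determined : ∀ v i j → Matching S (a ∷ as) (b ∷ bs) (v [ a ]≔ i) →
                 Matching S (a ∷ as) (b ∷ bs) (v [ a ]≔ j) → i ≡ j
    determined v i j mᵢ mⱼ = colour-injective a (trans (value v i mᵢ) (sym (value v j mⱼ)))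

  -- The union bound over the squares through one element

  N-mono : ∀ {S T} → (∀ {x} → x ∈ˢ S → x ∈ˢ T) → N T ≤ N S
  N-mono {S} {T} S⊆T = count-mono (avoids? T) (avoids? S) λ v av → av ∘ hasSquare-⊆ v S⊆T

  -- These are the facts that `bad-bound` needs about a sequence. Filtering `through` by them only
  -- shortens the list, so the bound `through-count` survives.
  Candidate : Fin m → ℕ → List (Fin m) → Set
  Candidate e j es = Unique es × length es ≡ suc j + suc j × e ∈ take (suc j) es

  candidate? : ∀ e j es → Dec (Candidate e j es)
  candidate? e j es = unique? es ×-dec length es ℕ.≟ suc j + suc j ×-dec e ∈? take (suc j) es

  candidates : Fin m → ℕ → List (List (Fin m))
  candidates e j = filter (candidate? e j) (through e j)

  bad? : ∀ T j es v → Dec (Matching T (take (suc j) es) (drop (suc j) es) v)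
  bad? T j es = matching? T (take (suc j) es) (drop (suc j) es)

  ∑bad : Subset m → Fin m → ℕ → ℕ
  ∑bad T e j = ∑ᴸ (candidates e j) λ es → count (bad? T j es)

  reverse-square : ∀ {n es} v → length es ≡ n + n → IsSquare n v es → IsSquare n v (reverse es)
  reverse-square {n} {es} v len sq = begin
    map f (take n (reverse es))  ≡⟨ cong (map f ∘ take n) rev ⟩
    map f (take n (bs ++ as))    ≡⟨ cong (map f) (take-++-length bs as bs-length) ⟩
    map f (reverse (drop n es))  ≡⟨ List.reverse-map f (drop n es) ⟩
    reverse (map f (drop n es))  ≡⟨ cong reverse sq ⟨
    reverse (map f (take n es))  ≡⟨ List.reverse-map f (take n es) ⟨
    map f (reverse (take n es))  ≡⟨ cong (map f) (drop-++-length bs as bs-length) ⟨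
    map f (drop n (bs ++ as))    ≡⟨ cong (map f ∘ drop n) rev ⟨
    map f (drop n (reverse es))  ∎
    where
    open ≡-Reasoning
    f  = v at_
    as = reverse (take n es)
    bs = reverse (drop n es)
    rev : reverse es ≡ bs ++ as
    rev = trans (cong reverse (sym (List.take++drop≡id n es))) (List.reverse-++ (take n es) (drop n es))
    bs-length : length bs ≡ n
    bs-length = trans (List.length-reverse (drop n es)) (length-drop-+ n es len)

  candidate-cover : ∀ {j es e} v → es ∈ squares (suc j) → Unique es → e ∈ es → IsSquare (suc j) v es →
                    ∃[ es′ ] es′ ∈ candidates e j × IsSquare (suc j) v es′
  candidate-cover {j} {es} {e} v es∈ u e∈ sq with squares-length es∈ | through-cover es∈ e∈
  ... | len | inj₁ (∈thr , e∈½) = es , ∈-filter⁺ (candidate? e j) ∈thr (u , len , e∈½) , sq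
  ... | len | inj₂ (∈thr , e∈½) = reverse es ,
    ∈-filter⁺ (candidate? e j) ∈thr (Unique-reverse u , trans (List.length-reverse es) len , e∈½) ,
    reverse-square v len sq

  private
    union-bound-at : ∀ S e v →
      𝟙 (avoids? (S -ˢ e) v) ≤
      𝟙 (avoids? S v) + ∑< M (λ j → ∑ᴸ (candidates e j) λ es → 𝟙 (bad? (S -ˢ e) j es v))
    union-bound-at S e v = 𝟙-≤ (avoids? (S -ˢ e) v) λ av → witness av (hasSquare? S v)
      where
      open ℕ.≤-Reasoning
      F = λ j → ∑ᴸ (candidates e j) λ es → 𝟙 (bad? (S -ˢ e) j es v)

      bad : ∀ {j es} → j < M → es ∈ candidates e j → ¬ HasSquare (S -ˢ e) v → IsSquare (suc j) v es →
            1 ≤ ∑< M F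
      bad {j} {es} j<M es∈ av sq = begin
        1                         ≡⟨ 𝟙-true (bad? (S -ˢ e) j es v) (av , sq) ⟨
        𝟙 (bad? (S -ˢ e) j es v)   ≤⟨ ∈⇒≤∑ᴸ (λ es → 𝟙 (bad? (S -ˢ e) j es v)) es∈ ⟩
        F j                       ≤⟨ <⇒≤∑< F j<M ⟩
        ∑< M F                    ∎

      witness : ¬ HasSquare (S -ˢ e) v → Dec (HasSquare S v) → 1 ≤ 𝟙 (avoids? S v) + ∑< M F
      witness av (no ¬sq) = ℕ.≤-trans (ℕ.≤-reflexive (sym (𝟙-true (avoids? S v) ¬sq))) (ℕ.m≤m+n _ _)
      witness av (yes (j , j<M , any)) with find any
      ... | es , es∈ , u , ⊆S , sq with e ∈? es
      ... | yes e∈ = let es′ , es′∈ , sq′ = candidate-cover v es∈ u e∈ sq in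
                     ℕ.≤-trans (bad j<M es′∈ av sq′) (ℕ.m≤n+m _ _)
      -- A square that misses `e` already lies in `S -ˢ e`, which the choice avoids.
      ... | no  e∉ = contradiction (j , j<M , lose es∈ (u , All.tabulate in-S-e , sq)) av
        where
        in-S-e : ∀ {x} → x ∈ es → x ∈ˢ S -ˢ e
        in-S-e x∈ = Subset.x∈p∧x≢y⇒x∈p-y (All.lookup ⊆S x∈) λ { refl → e∉ x∈ }

  union-bound : ∀ S e → N (S -ˢ e) ≤ N S + ∑< M (∑bad (S -ˢ e) e)
  union-bound S e = begin
    N (S -ˢ e)
      ≤⟨ total-mono (union-bound-at S e) ⟩
    total (λ v → 𝟙 (avoids? S v) + ∑< M λ j → bads j v)
      ≡⟨ total-+ (λ v → 𝟙 (avoids? S v)) (λ v → ∑< M λ j → bads j v) ⟩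
    N S + total (λ v → ∑< M λ j → bads j v)
      ≡⟨ cong (_+_ (N S)) (total-∑< M bads) ⟩
    N S + ∑< M (λ j → total (bads j))
      ≡⟨ cong (_+_ (N S)) (∑<-cong M λ j → total-∑ᴸ (candidates e j) λ es v → 𝟙 (bad? (S -ˢ e) j es v)) ⟩
    N S + ∑< M (∑bad (S -ˢ e) e) ∎
    where
    open ℕ.≤-Reasoning
    bads : ℕ → Choice → ℕ
    bads j v = ∑ᴸ (candidates e j) λ es → 𝟙 (bad? (S -ˢ e) j es v)

  -- The ratio N (S - e) / N S ≤ k / β in multiplied form. The index bounds the size of `S` for the
  -- induction; `e` may also lie outside `S`.
  Growth : ℕ → Set
  Growth n = ∀ S e → ∣ S ∣ ≤ n → β * N (S -ˢ e) ≤ k * N S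

  -- The ratios telescope. Removals never enlarge the set, so a single `Growth n` serves every step,
  -- and elements of `as` that are absent or repeated do no harm.
  growth-∖ : ∀ {n} → Growth n → ∀ S as → ∣ S ∣ ≤ n → β ^ length as * N (S ∖ as) ≤ k ^ length as * N S
  growth-∖ G S []       S≤n = ℕ.≤-refl
  growth-∖ G S (a ∷ as) S≤n = begin
    β * β ^ length as * N ((S -ˢ a) ∖ as)    ≡⟨ ℕ.*-assoc β _ _ ⟩
    β * (β ^ length as * N ((S -ˢ a) ∖ as))
      ≤⟨ ℕ.*-monoʳ-≤ β (growth-∖ G (S -ˢ a) as (ℕ.≤-trans (Subset.∣p─q∣≤∣p∣ S ⁅ a ⁆) S≤n)) ⟩
    β * (k ^ length as * N (S -ˢ a))         ≡⟨ swap β (k ^ length as) (N (S -ˢ a)) ⟩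
    k ^ length as * (β * N (S -ˢ a))         ≤⟨ ℕ.*-monoʳ-≤ (k ^ length as) (G S a S≤n) ⟩
    k ^ length as * (k * N S)               ≡⟨ assemble (k ^ length as) k (N S) ⟩
    k * k ^ length as * N S                 ∎
    where
    open ℕ.≤-Reasoning
    swap : ∀ x y c → x * (y * c) ≡ y * (x * c)
    swap = solve-∀
    assemble : ∀ y x c → y * (x * c) ≡ x * y * c
    assemble = solve-∀

  -- The half containing e is determined by the other half; uncolouring it except
  -- for e itself, which is not in T anyway, costs j factors of k / β.
  bad-bound : ∀ {n T e j es} → Growth n → ∣ T ∣ ≤ n → e ∉ˢ T → Candidate e j es →
              β ^ j * (k * count (bad? T j es)) ≤ N T
  bad-bound {n} {T} {e} {j} {es} G T≤n e∉T (u , len , e∈) = ℕ.*-cancelˡ-≤ (k ^ j) {{ℕ.m^n≢0 k j}} (begin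
    k ^ j * (β ^ j * (k * count (bad? T j es)))
      ≡⟨ regroup (k ^ j) (β ^ j) k _ ⟩
    β ^ j * (k ^ suc j * count (bad? T j es))
      ≤⟨ ℕ.*-monoʳ-≤ (β ^ j) (ℕ.*-monoʳ-≤ (k ^ suc j) (count-mono (bad? T j es) (bad? U j es)
           λ v (av , eq) → av ∘ hasSquare-⊆ v (∖-⊆ T others) , eq)) ⟩
    β ^ j * (k ^ suc j * count (bad? U j es))
      ≡⟨ cong (λ l → β ^ j * (k ^ l * count (bad? U j es))) (sym as-length) ⟩
    β ^ j * (k ^ length as * count (bad? U j es))
      ≤⟨ ℕ.*-monoʳ-≤ (β ^ j) (count-matching U as bs (trans as-length (sym (length-drop-+ (suc j) es len)))
           (Unique-++⇒ˡ u′) (Unique-++⇒∉ u′) as∉U) ⟩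
    β ^ j * N U
      ≡⟨ cong (λ l → β ^ l * N U) (sym others-length) ⟩
    β ^ length others * N U
      ≤⟨ growth-∖ G T others T≤n ⟩
    k ^ length others * N T
      ≡⟨ cong (λ l → k ^ l * N T) others-length ⟩
    k ^ j * N T ∎)
    where
    open ℕ.≤-Reasoning
    as = take (suc j) es
    bs = drop (suc j) es
    u′ : Unique (as ++ bs)
    u′ = subst Unique (sym (List.take++drop≡id (suc j) es)) u

    as-length : length as ≡ suc j
    as-length = length-take-+ (suc j) es len

    split = ∈-∃++ e∈
    xs = proj₁ split
    ys = proj₁ (proj₂ split)
    as≡ : as ≡ xs ++ e ∷ ys
    as≡ = proj₂ (proj₂ split)

    others = xs ++ ys
    U = T ∖ others

    others-length : length others ≡ j
    others-length = ℕ.suc-injective (begin-equality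
      suc (length (xs ++ ys))      ≡⟨ cong suc (List.length-++ xs) ⟩
      suc (length xs + length ys)  ≡⟨ ℕ.+-suc (length xs) (length ys) ⟨
      length xs + suc (length ys)  ≡⟨ List.length-++ xs ⟨
      length (xs ++ e ∷ ys)        ≡⟨ cong length as≡ ⟨
      length as                    ≡⟨ as-length ⟩
      suc j                        ∎)

    as∉U : ∀ {a} → a ∈ as → a ∉ˢ U
    as∉U {a} a∈ a∈U with ∈-++⁻ xs (subst (a ∈_) as≡ a∈)
    ... | inj₁ a∈xs         = ∈⇒∉∖ T others (∈-++⁺ˡ a∈xs) a∈U
    ... | inj₂ (here refl)  = e∉T (∖-⊆ T others a∈U)
    ... | inj₂ (there a∈ys) = ∈⇒∉∖ T others (∈-++⁺ʳ xs a∈ys) a∈U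

    regroup : ∀ x y z c → x * (y * (z * c)) ≡ y * (z * x * c)
    regroup = solve-∀

  -- This is the hypothesis of `arithmetico-geometric` with `B j = k * ∑bad T e j` and
  -- `Z = z * N T`.
  ∑bad-bound : ∀ {n T e} → Growth n → ∣ T ∣ ≤ n → e ∉ˢ T → ∀ j →
               β ^ j * (k * ∑bad T e j) ≤ suc j * q ^ j * (z * N T)
  ∑bad-bound {n} {T} {e} G T≤n e∉T j = begin
    β ^ j * (k * ∑bad T e j)
      ≡⟨ ℕ.*-assoc (β ^ j) k _ ⟨
    β ^ j * k * ∑bad T e j
      ≤⟨ ∑ᴸ-bound {c = β ^ j * k} (candidates e j) (λ es → count (bad? T j es)) (λ es∈ →
           ℕ.≤-trans (ℕ.≤-reflexive (ℕ.*-assoc (β ^ j) k _))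
             (bad-bound G T≤n e∉T (proj₂ (∈-filter⁻ (candidate? e j) {xs = through e j} es∈)))) ⟩
    length (candidates e j) * N T
      ≤⟨ ℕ.*-monoˡ-≤ (N T) (ℕ.≤-trans (List.length-filter (candidate? e j) (through e j)) (through-count e j)) ⟩
    suc j * q ^ j * z * N T
      ≡⟨ ℕ.*-assoc (suc j * q ^ j) z (N T) ⟩
    suc j * q ^ j * (z * N T) ∎
    where open ℕ.≤-Reasoning

  total-bad-bound : ∀ {n T e} → Growth n → ∣ T ∣ ≤ n → e ∉ˢ T → k * ∑< M (∑bad T e) ≤ s * N T
  total-bad-bound {n} {T} {e} G T≤n e∉T =
    ℕ.*-cancelʳ-≤ _ _ (t * t) {{ℕ.m*n≢0 t t}} (ℕ.*-cancelˡ-≤ (β ^ M) {{ℕ.m^n≢0 β M}} (begin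
      β ^ M * (k * ∑< M (∑bad T e) * (t * t))
        ≡⟨ cong (λ x → β ^ M * (x * (t * t))) (∑<-*ˡ k M (∑bad T e)) ⟩
      β ^ M * (∑< M weighted * (t * t))
        ≡⟨ rotate (β ^ M) (∑< M weighted) (t * t) ⟩
      t * t * ∑< M weighted * β ^ M
        -- Makes room for the tail of the series beyond the cut-off `M`, which
        -- `arithmetico-geometric` carries along.
        ≤⟨ ℕ.m≤m+n _ _ ⟩
      t * t * ∑< M weighted * β ^ M + q ^ M * β * (suc M * t + q) * (z * N T)
        ≤⟨ arithmetico-geometric q t (z * N T) weighted (∑bad-bound G T≤n e∉T) M ⟩
      β ^ M * (β * β * (z * N T))
        ≡⟨ cong (β ^ M *_) (regroup (β * β) z (N T)) ⟩
      β ^ M * (z * (β * β) * N T)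
        ≤⟨ ℕ.*-monoʳ-≤ (β ^ M) (ℕ.*-monoˡ-≤ (N T) balance) ⟩
      β ^ M * (s * (t * t) * N T)
        ≡⟨ cong (β ^ M *_) (regroup′ s (t * t) (N T)) ⟩
      β ^ M * (s * N T * (t * t)) ∎))
    where
    open ℕ.≤-Reasoning
    weighted = λ j → k * ∑bad T e j
    rotate : ∀ x y c → x * (y * c) ≡ c * y * x
    rotate = solve-∀
    regroup : ∀ x y c → x * (y * c) ≡ y * x * c
    regroup = solve-∀
    regroup′ : ∀ x y c → x * y * c ≡ x * c * y
    regroup′ = solve-∀

  growth : ∀ n → Growth n
  growth n S e S≤n with e Subset.∈? S
  -- Here `S` is contained in `S -ˢ e`, so nothing is lost and β ≤ k is enough.
  growth n S e S≤n | no e∉S = ℕ.*-mono-≤ (ℕ.m≤m+n β s)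
    (N-mono λ x∈ → Subset.x∈p∧x≢y⇒x∈p-y x∈ λ { refl → e∉S x∈ })
  growth zero    S e S≤n | yes e∈S = contradiction (ℕ.≤-trans (Subset.x∈p⇒∣p-x∣<∣p∣ e∈S) S≤n) λ ()
  -- The loss is at most `s * N T`, exactly the surplus in `k * N T = β * N T + s * N T`, so the two
  -- cancel.
  growth (suc n) S e S≤n | yes e∈S = ℕ.+-cancelʳ-≤ (s * N T) _ _ (begin
    β * N T + s * N T                     ≡⟨ ℕ.*-distribʳ-+ (N T) β s ⟨
    k * N T                               ≤⟨ ℕ.*-monoʳ-≤ k (union-bound S e) ⟩
    k * (N S + ∑< M (∑bad T e))           ≡⟨ ℕ.*-distribˡ-+ k (N S) _ ⟩
    k * N S + k * ∑< M (∑bad T e)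
      ≤⟨ ℕ.+-monoʳ-≤ (k * N S) (total-bad-bound (growth n) T≤n (x∉p-x S e)) ⟩
    k * N S + s * N T                     ∎)
    where
    open ℕ.≤-Reasoning
    T = S -ˢ e
    T≤n : ∣ T ∣ ≤ n
    T≤n = ℕ.≤-pred (ℕ.≤-trans (Subset.x∈p⇒∣p-x∣<∣p∣ e∈S) S≤n)

  -- Emptying `⊤` element by element bounds `N ⊤` below by a positive multiple of the count for the
  -- empty set. That count is k^m, as a square of positive period has an element.
  ∃-squareFree : ∃[ v ] ∀ {j es} → j < M → es ∈ squares (suc j) → Unique es → ¬ IsSquare (suc j) v es
  ∃-squareFree =
    let v , 0<𝟙 = total-positive⇒∃ (λ v → 𝟙 (avoids? ⊤ v)) N⊤>0
        av = 𝟙-positive (avoids? ⊤ v) 0<𝟙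
    in v , λ j<M es∈ u sq → av (_ , j<M , lose es∈ (u , All.universal (λ _ → Subset.∈⊤) _ , sq))
    where
    E = allFin m

    avoids-∅ : ∀ v → ¬ HasSquare (⊤ ∖ E) v
    avoids-∅ v (j , _ , any) with find any
    ... | []     , es∈ , _ = contradiction (squares-length es∈) λ ()
    ... | x ∷ es , es∈ , _ , x∈ ∷ _ , _ = ∈⇒∉∖ ⊤ E (∈-allFin x) x∈

    N∅>0 : 0 < N (⊤ ∖ E)
    N∅>0 = begin-strict
      0                            <⟨ ℕ.m^n>0 k m ⟩
      k ^ m                        ≡⟨ ℕ.*-identityʳ (k ^ m) ⟨
      k ^ m * 1                    ≡⟨ total-const k m 1 ⟨
      total {k} {m} (λ _ → 1)
        ≤⟨ total-mono (λ v → ℕ.≤-reflexive (sym (𝟙-true (avoids? (⊤ ∖ E) v) (avoids-∅ v)))) ⟩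
      N (⊤ ∖ E)                    ∎
      where open ℕ.≤-Reasoning

    N⊤>0 : 0 < N ⊤
    N⊤>0 = ℕ.n≢0⇒n>0 λ N⊤≡0 → ℕ.<-irrefl refl (begin-strict
      0                             <⟨ ℕ.*-mono-< (ℕ.m^n>0 β (length E)) N∅>0 ⟩
      β ^ length E * N (⊤ ∖ E)      ≤⟨ growth-∖ (growth ∣ ⊤ {m} ∣) ⊤ E ℕ.≤-refl ⟩
      k ^ length E * N ⊤            ≡⟨ cong (k ^ length E *_) N⊤≡0 ⟩
      k ^ length E * 0              ≡⟨ ℕ.*-zeroʳ (k ^ length E) ⟩
      0                             ∎)
      where open ℕ.≤-Reasoning

-- Walks and paths

length-concatMap-≤ : ∀ {b} (f : A → List B) xs → (∀ {x} → x ∈ xs → length (f x) ≤ b) →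
                     length (concatMap f xs) ≤ length xs * b
length-concatMap-≤ f []       bound = z≤n
length-concatMap-≤ f (x ∷ xs) bound = ℕ.≤-trans
  (ℕ.≤-reflexive (List.length-++ (f x)))
  (ℕ.+-mono-≤ (bound (here refl)) (length-concatMap-≤ f xs (bound ∘ there)))

∈-take-++ : ∀ {n} (xs : List A) {x ys} → length xs < n → x ∈ take n (xs ++ x ∷ ys)
∈-take-++ []       (s≤s _)   = here refl
∈-take-++ (y ∷ xs) (s≤s xs<n) = there (∈-take-++ xs xs<n)

take-tabulate : ∀ m {n} (f : Fin (m + n) → A) → take m (tabulate f) ≡ tabulate (f ∘ (_↑ˡ n))
take-tabulate zero    f = refl
take-tabulate (suc m) f = cong (f zero ∷_) (take-tabulate m (f ∘ suc))

drop-tabulate : ∀ m {n} (f : Fin (m + n) → A) → drop m (tabulate f) ≡ tabulate (f ∘ (m ↑ʳ_))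
drop-tabulate zero    f = refl
drop-tabulate (suc m) f = drop-tabulate m (f ∘ suc)

Unique⇒lookup-injective : {xs : List A} → Unique xs → Injective _≡_ _≡_ (List.lookup xs)
Unique⇒lookup-injective (_  ∷ _) {zero}  {zero}  _  = refl
Unique⇒lookup-injective (x∉ ∷ _) {zero}  {suc j} eq = contradiction eq (All.lookup x∉ (∈-lookup j))
Unique⇒lookup-injective (x∉ ∷ _) {suc i} {zero}  eq = contradiction (sym eq) (All.lookup x∉ (∈-lookup i))
Unique⇒lookup-injective (_  ∷ u) {suc i} {suc j} eq = cong suc (Unique⇒lookup-injective u eq)

module _ (G : Graph) where
  open Graph G hiding (maxDegree)

  private
    Δ = maxDegree G

  degree≤Δ : ∀ v → degree v ≤ Δ
  degree≤Δ v = All.lookup (xs≤max 0 (map degree (allFin order))) (∈-map⁺ degree (∈-allFin v))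

  joins-sym : ∀ {e u v} → Joins e u v → Joins e v u
  joins-sym = Sum.swap

  joins-unique : ∀ {e u v u′ v′} → Joins e u v → Joins e u′ v′ → (u ≡ u′ × v ≡ v′) ⊎ (u ≡ v′ × v ≡ u′)
  joins-unique (inj₁ (refl , refl)) js′ = js′
  joins-unique (inj₂ (refl , refl)) js′ = Sum.map (λ (p , q) → q , p) (λ (p , q) → q , p) (Sum.swap js′)

  -- For an edge not incident to the vertex the value `src e` is a mere default; `walks` follows
  -- incident edges only.
  other : Vertex → Edge → Vertex
  other v e with src e Fin.≟ v
  ... | yes _ = tgt e
  ... | no  _ = src e

  joins⇒other : ∀ {e u v} → Joins e u v → other u e ≡ v
  joins⇒other {e} {u} js with src e Fin.≟ u | js
  ... | yes _   | inj₁ (_ , t≡v) = t≡v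
  ... | yes s≡u | inj₂ (_ , t≡u) = contradiction (src<tgt e) (Fin.<-irrefl (trans s≡u (sym t≡u)))
  ... | no  s≢u | inj₁ (s≡u , _) = contradiction s≡u s≢u
  ... | no  _   | inj₂ (s≡v , _) = s≡v

  joins⇒incident : ∀ {e u v} → Joins e u v → Incident u e
  joins⇒incident = Sum.map proj₁ proj₂

  incident⇒joins : ∀ {e u} → Incident u e → Joins e u (other u e)
  incident⇒joins {e} {u} inc with src e Fin.≟ u | inc
  ... | yes s≡u | _        = inj₁ (s≡u , refl)
  ... | no  s≢u | inj₁ s≡u = contradiction s≡u s≢u
  ... | no  _   | inj₂ t≡u = inj₂ (refl , t≡u)

  data Walk : Vertex → List Edge → Vertex → Set where
    []  : ∀ {u} → Walk u [] u
    _∷_ : ∀ {e es u v w} → Joins e u v → Walk v es w → Walk u (e ∷ es) w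

  walk-++ : ∀ {xs ys u v w} → Walk u xs v → Walk v ys w → Walk u (xs ++ ys) w
  walk-++ []       q = q
  walk-++ (js ∷ p) q = js ∷ walk-++ p q

  walk-reverse : ∀ {es u w} → Walk u es w → Walk w (reverse es) u
  walk-reverse [] = []
  walk-reverse {e ∷ es} (js ∷ p) = subst (λ es → Walk _ es _) (sym (List.unfold-reverse e es))
    (walk-++ (walk-reverse p) (joins-sym js ∷ []))

  walk-split : ∀ xs {e ys u w} → Walk u (xs ++ e ∷ ys) w →
               ∃₂ λ a b → Walk u xs a × Joins e a b × Walk b ys w
  walk-split []       (js ∷ p) = _ , _ , [] , js , p
  walk-split (x ∷ xs) (js ∷ p) =
    let a , b , l , js′ , r = walk-split xs p in a , b , js ∷ l , js′ , r

  walk-tabulate : ∀ {n} (vs : Fin (suc n) → Vertex) (es : Fin n → Edge) →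
                  (∀ i → Joins (es i) (vs (inject₁ i)) (vs (suc i))) →
                  Walk (vs zero) (tabulate es) (vs (fromℕ n))
  walk-tabulate {zero}  vs es js = []
  walk-tabulate {suc n} vs es js = js zero ∷ walk-tabulate (vs ∘ suc) (es ∘ suc) (js ∘ suc)

  walks : Vertex → ℕ → List (List Edge)
  walks v zero    = [ [] ]
  walks v (suc n) = concatMap (λ e → map (e ∷_) (walks (other v e) n)) (filter (incident? v) (allFin size))

  walks-sound : ∀ v n {es} → es ∈ walks v n → length es ≡ n × ∃ (Walk v es)
  walks-sound v zero    (here refl) = refl , v , []
  walks-sound v (suc n) es∈
    with find (∈-concatMap⁻ (λ e → map (e ∷_) (walks (other v e) n))
                 {xs = filter (incident? v) (allFin size)} es∈)
  ... | e , e∈ , es∈′ with ∈-map⁻ (e ∷_) es∈′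
  ... | es , es∈″ , refl with walks-sound (other v e) n es∈″
  ... | len , w , p = cong suc len , w ,
    incident⇒joins (proj₂ (∈-filter⁻ (incident? v) {xs = allFin size} e∈)) ∷ p

  walks-complete : ∀ {v es w} → Walk v es w → es ∈ walks v (length es)
  walks-complete [] = here refl
  walks-complete {v} {e ∷ es} (js ∷ p) = ∈-concatMap⁺ (λ e → map (e ∷_) (walks (other v e) (length es)))
    (lose (∈-filter⁺ (incident? v) (∈-allFin e) (joins⇒incident js))
      (∈-map⁺ (e ∷_) (subst (λ u → es ∈ walks u (length es)) (sym (joins⇒other js)) (walks-complete p))))

  length-walks : ∀ v n → length (walks v n) ≤ Δ ^ n
  length-walks v zero    = s≤s z≤n
  length-walks v (suc n) = ℕ.≤-trans
    (length-concatMap-≤ (λ e → map (e ∷_) (walks (other v e) n)) (filter (incident? v) (allFin size))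
      λ {e} _ →
      ℕ.≤-trans (ℕ.≤-reflexive (List.length-map (e ∷_) (walks (other v e) n))) (length-walks (other v e) n))
    (ℕ.*-monoˡ-≤ (Δ ^ n) (degree≤Δ v))

  squares : ℕ → List (List Edge)
  squares n = concatMap (λ v → walks v (n + n)) (allFin order)

  squares-sound : ∀ {n es} → es ∈ squares n → length es ≡ n + n × ∃₂ λ u w → Walk u es w
  squares-sound {n} es∈ with find (∈-concatMap⁻ (λ v → walks v (n + n)) {xs = allFin order} es∈)
  ... | v , _ , es∈′ with walks-sound v (n + n) es∈′
  ... | len , w , p = len , v , w , p

  squares-complete : ∀ {n es u w} → length es ≡ n + n → Walk u es w → es ∈ squares n
  squares-complete {n} {es} {u} len p = ∈-concatMap⁺ (λ v → walks v (n + n))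
    (lose (∈-allFin u) (subst (λ l → es ∈ walks u l) len (walks-complete p)))

  -- The sequence grows outwards from `e`: the left part is enumerated as a walk leaving `a` and
  -- then reversed. Anchoring both parts at `e` avoids a factor for the choice of a starting vertex.
  around : Edge → Vertex → Vertex → ℕ → ℕ → List (List Edge)
  around e a b l r = concatMap (λ xs → map (λ ys → reverse xs ++ e ∷ ys) (walks b r)) (walks a l)

  length-around : ∀ e a b l r → length (around e a b l r) ≤ Δ ^ (l + r)
  length-around e a b l r = ℕ.≤-trans
    (length-concatMap-≤ (λ xs → map (λ ys → reverse xs ++ e ∷ ys) (walks b r)) (walks a l) λ {xs} _ →
      ℕ.≤-trans (ℕ.≤-reflexive (List.length-map (λ ys → reverse xs ++ e ∷ ys) (walks b r))) (length-walks b r))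
    (ℕ.≤-trans (ℕ.*-monoˡ-≤ (Δ ^ r) (length-walks a l)) (ℕ.≤-reflexive (sym (ℕ.^-distribˡ-+-* Δ l r))))

  ∈-around : ∀ {e a b u w xs ys} → Walk u xs a → Walk b ys w →
             xs ++ e ∷ ys ∈ around e a b (length xs) (length ys)
  ∈-around {e} {a} {b} {xs = xs} {ys} p q =
    ∈-concatMap⁺ (λ xs → map (λ ys → reverse xs ++ e ∷ ys) (walks b (length ys)))
      (lose (subst (λ l → reverse xs ∈ walks a l) (List.length-reverse xs) (walks-complete (walk-reverse p)))
        (subst (λ zs → zs ++ e ∷ ys ∈ map (λ ys → reverse (reverse xs) ++ e ∷ ys) (walks b (length ys)))
          (List.reverse-involutive xs)
          (∈-map⁺ (λ ys → reverse (reverse xs) ++ e ∷ ys) (walks-complete q))))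

  -- Here `l` edges precede `e`, and the other `j + suc j ∸ l` of the 2j + 1 remaining edges follow
  -- it. The two summands are the two directions in which `e` can be traversed.
  through-at : Edge → ℕ → ℕ → List (List Edge)
  through-at e j l = around e (src e) (tgt e) l (j + suc j ∸ l) ++ around e (tgt e) (src e) l (j + suc j ∸ l)

  through : Edge → ℕ → List (List Edge)
  through e j = concatMap (through-at e j) (upTo (suc j))

  through-count : ∀ e j → length (through e j) ≤ suc j * (Δ ^ 2) ^ j * (2 * Δ)
  through-count e j = begin
    length (through e j)
      ≤⟨ length-concatMap-≤ (through-at e j) (upTo (suc j)) at-bound ⟩
    length (upTo (suc j)) * (Δ ^ (j + suc j) + Δ ^ (j + suc j))
      ≡⟨ cong₂ (λ n d → n * (d + d)) (List.length-upTo (suc j)) power ⟩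
    suc j * (Δ * (Δ ^ 2) ^ j + Δ * (Δ ^ 2) ^ j)            ≡⟨ collect (suc j) Δ ((Δ ^ 2) ^ j) ⟩
    suc j * (Δ ^ 2) ^ j * (2 * Δ)                          ∎
    where
    open ℕ.≤-Reasoning

    -- Splitting off one factor Δ leaves a power of Δ², which fixes the parameters `q` = Δ² and `z`
    -- = 2Δ of the count.
    power : Δ ^ (j + suc j) ≡ Δ * (Δ ^ 2) ^ j
    power = trans (cong (Δ ^_) (double j)) (cong (Δ *_) (sym (ℕ.^-*-assoc Δ 2 j)))
      where
      double : ∀ j → j + suc j ≡ suc (2 * j)
      double = solve-∀

    collect : ∀ n d x → n * (d * x + d * x) ≡ n * x * (2 * d)
    collect = solve-∀

    at-bound : ∀ {l} → l ∈ upTo (suc j) → length (through-at e j l) ≤ Δ ^ (j + suc j) + Δ ^ (j + suc j)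
    at-bound {l} l∈ = ℕ.≤-trans
      (ℕ.≤-reflexive (List.length-++ (left l)))
      (subst (λ n → length (left l) + length (right l) ≤ Δ ^ n + Δ ^ n)
        (ℕ.m+[n∸m]≡n (ℕ.≤-trans (ℕ.≤-pred (∈-upTo⁻ l∈)) (ℕ.m≤m+n j (suc j))))
        (ℕ.+-mono-≤ (length-around e (src e) (tgt e) l (j + suc j ∸ l))
          (length-around e (tgt e) (src e) l (j + suc j ∸ l))))
      where
      left right : ℕ → List (List Edge)
      left  l = around e (src e) (tgt e) l (j + suc j ∸ l)
      right l = around e (tgt e) (src e) l (j + suc j ∸ l)

  ∈-through : ∀ {e j xs ys u w} → Walk u (xs ++ e ∷ ys) w → length xs ≤ j →
              length xs + length ys ≡ j + suc j →
              xs ++ e ∷ ys ∈ through e j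
  ∈-through {e} {j} {xs} {ys} p xs≤j len = ∈-concatMap⁺ (through-at e j)
    (lose (∈-upTo⁺ (s≤s xs≤j)) (subst (λ r → xs ++ e ∷ ys ∈ arounds r) ys-length (both (walk-split xs p))))
    where
    arounds : ℕ → List (List Edge)
    arounds r = around e (src e) (tgt e) (length xs) r ++ around e (tgt e) (src e) (length xs) r

    ys-length : length ys ≡ j + suc j ∸ length xs
    ys-length = trans (sym (ℕ.m+n∸m≡n (length xs) (length ys))) (cong (_∸ length xs) len)

    both : (∃₂ λ a b → Walk _ xs a × Joins e a b × Walk b ys _) → xs ++ e ∷ ys ∈ arounds (length ys)
    both (_ , _ , l , inj₁ (refl , refl) , r) = ∈-++⁺ˡ (∈-around l r)
    both (_ , _ , l , inj₂ (refl , refl) , r) = ∈-++⁺ʳ _ (∈-around l r)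

  -- Of the 2j + 1 other edges at most j precede `e` or at most j follow it; the second case becomes
  -- the first after reversal.
  through-cover : ∀ {j es e} → es ∈ squares (suc j) → e ∈ es →
    (es ∈ through e j × e ∈ take (suc j) es) ⊎
    (reverse es ∈ through e j × e ∈ take (suc j) (reverse es))
  through-cover {j} {es} {e} es∈ e∈ with squares-sound {suc j} es∈ | ∈-∃++ e∈
  ... | len , _ , _ , p | xs , ys , refl = cases (ℕ.≤-<-connex (length xs) j)
    where
    sum-length : length xs + length ys ≡ j + suc j
    sum-length = ℕ.suc-injective (trans (sym (ℕ.+-suc (length xs) (length ys)))
      (trans (sym (List.length-++ xs)) len))

    rev : reverse (xs ++ e ∷ ys) ≡ reverse ys ++ e ∷ reverse xs
    rev = trans (List.reverse-++ xs (e ∷ ys)) (trans (cong (_++ reverse xs) (List.unfold-reverse e ys))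
            (List.++-assoc (reverse ys) [ e ] (reverse xs)))

    cases : length xs ≤ j ⊎ j < length xs → _
    cases (inj₁ xs≤j) = inj₁ (∈-through p xs≤j sum-length , ∈-take-++ xs (s≤s xs≤j))
    cases (inj₂ j<xs) = inj₂ (subst (λ zs → zs ∈ through e j × e ∈ take (suc j) zs) (sym rev)
      (∈-through (subst (λ zs → Walk _ zs _) rev (walk-reverse p)) ys≤j rev-length ,
       ∈-take-++ (reverse ys) (s≤s ys≤j)))
      where
      ys≤j : length (reverse ys) ≤ j
      ys≤j = ℕ.+-cancelˡ-≤ (suc j) _ _ (begin
        suc j + length (reverse ys)  ≡⟨ cong (_+_ (suc j)) (List.length-reverse ys) ⟩
        suc j + length ys            ≤⟨ ℕ.+-monoˡ-≤ (length ys) j<xs ⟩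
        length xs + length ys        ≡⟨ sum-length ⟩
        j + suc j                    ≡⟨ ℕ.+-comm j (suc j) ⟩
        suc j + j                    ∎)
        where open ℕ.≤-Reasoning

      rev-length : length (reverse ys) + length (reverse xs) ≡ j + suc j
      rev-length = trans (cong₂ _+_ (List.length-reverse ys) (List.length-reverse xs))
        (trans (ℕ.+-comm (length ys) (length xs)) sum-length)

  -- Equal edges have the same two ends. In the same order these give equal indices; in opposite
  -- order each index would be the successor of the other.
  path-edge-injective : ∀ {n} (p : Path n) → Injective _≡_ _≡_ (Path.edge p)
  path-edge-injective p {x} {y} eq with joins-unique (joins x) (subst (λ e → Joins e _ _) (sym eq) (joins y))
    where open Path p
  ... | inj₁ (_ , vx≡vy) = Fin.suc-injective (Path.vertex-injective p vx≡vy)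
  ... | inj₂ (vx≡vy+ , vx+≡vy) = contradiction
    (ℕ.≤-reflexive (trans (cong toℕ (Path.vertex-injective p vx+≡vy)) (Fin.toℕ-inject₁ y)))
    (ℕ.<-asym (ℕ.≤-reflexive (trans (cong toℕ (sym (Path.vertex-injective p vx≡vy+))) (Fin.toℕ-inject₁ x))))

  choosable : ∀ t s .{{_ : NonZero t}} → 2 * Δ * ((Δ ^ 2 + t) * (Δ ^ 2 + t)) ≤ s * (t * t) →
              NonRepetitivelyChoosable G (Δ ^ 2 + t + s)
  choosable t s balance L uniq long =
    (λ e → colour e (Vec.lookup v e)) , (λ e → ∈-lookup (inject≤ (Vec.lookup v e) (long e))) , nonRepetitive
    where
    colour : Edge → Fin (Δ ^ 2 + t + s) → ℕ
    colour e i = List.lookup (L e) (inject≤ i (long e))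

    colour-injective : ∀ e → Injective _≡_ _≡_ (colour e)
    colour-injective e eq = Fin.inject≤-injective _ _ _ _ (Unique⇒lookup-injective (uniq e) eq)

    open Rosenfeld size order (Δ ^ 2) t s (2 * Δ) colour colour-injective
      squares (λ {n} es∈ → proj₁ (squares-sound {n} es∈)) through through-count through-cover balance

    v = proj₁ ∃-squareFree

    nonRepetitive : NonRepetitive G (λ e → colour e (Vec.lookup v e))
    nonRepetitive (suc j) _ p rep = proj₂ ∃-squareFree j<order
      (squares-complete {h} (List.length-tabulate edge) (walk-tabulate vertex edge joins))
      (Unique.tabulate⁺ (path-edge-injective p)) (begin
        map (v at_) (take h (tabulate edge))        ≡⟨ cong (map (v at_)) (take-tabulate h edge) ⟩
        map (v at_) (tabulate (edge ∘ (_↑ˡ h)))     ≡⟨ List.map-tabulate (edge ∘ (_↑ˡ h)) (v at_) ⟩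
        tabulate ((v at_) ∘ edge ∘ (_↑ˡ h))         ≡⟨ List.tabulate-cong rep ⟩
        tabulate ((v at_) ∘ edge ∘ (h ↑ʳ_))         ≡⟨ List.map-tabulate (edge ∘ (h ↑ʳ_)) (v at_) ⟨
        map (v at_) (tabulate (edge ∘ (h ↑ʳ_)))     ≡⟨ cong (map (v at_)) (drop-tabulate h edge) ⟨
        map (v at_) (drop h (tabulate edge))        ∎)
      where
      open Path p
      open ≡-Reasoning
      h = suc j
      -- The path has 2(j + 1) + 1 distinct vertices, so the cut-off at `order` misses no period.
      j<order : j < order
      j<order = ℕ.≤-trans (ℕ.m≤m+n h h) (ℕ.<⇒≤ (Fin.injective⇒≤ vertex-injective))

-- Asymptotics

cube-pos : ∀ n → (+ n) ℤ.^ 3 ≡ + (n ^ 3)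
cube-pos n = begin
  + n ℤ.* (+ n ℤ.* (+ n ℤ.* + 1))  ≡⟨ cong (λ x → + n ℤ.* (+ n ℤ.* x)) (ℤ.pos-* n 1) ⟨
  + n ℤ.* (+ n ℤ.* + (n * 1))      ≡⟨ cong (+ n ℤ.*_) (ℤ.pos-* n (n * 1)) ⟨
  + n ℤ.* + (n * (n * 1))          ≡⟨ ℤ.pos-* n (n * (n * 1)) ⟨
  + (n ^ 3)                        ∎
  where open ≡-Reasoning

-- The integer `x` may be negative; its cube is then negative and below any natural number.
≤∛-intro : ∀ {x n y} → x ℤ.≤ + n → n ^ 3 ≤ y → x ≤∛ + y
≤∛-intro {+ a} {n} (ℤ.+≤+ a≤n) n³≤y = subst (ℤ._≤ _) (sym (cube-pos a))
  (ℤ.+≤+ (ℕ.≤-trans (ℕ.^-monoˡ-≤ 3 a≤n) n³≤y))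
≤∛-intro { -[1+ a ]} ℤ.-≤+ _ = ℤ.-≤+

^-distribʳ-* : ∀ a b n → (a * b) ^ n ≡ a ^ n * b ^ n
^-distribʳ-* a b zero    = refl
^-distribʳ-* a b (suc n) = trans (cong (a * b *_) (^-distribʳ-* a b n)) (interchange a b (a ^ n) (b ^ n))
  where
  interchange : ∀ a b c d → a * b * (c * d) ≡ a * c * (b * d)
  interchange = solve-∀

^-swap : ∀ a m n → (a ^ m) ^ n ≡ (a ^ n) ^ m
^-swap a m n = trans (ℕ.^-*-assoc a m n) (trans (cong (a ^_) (ℕ.*-comm m n)) (sym (ℕ.^-*-assoc a n m)))

halfCubeRoot : ∀ n → ∃[ v ] 8 * v ^ 3 ≤ n × n ≤ 8 * suc v ^ 3
halfCubeRoot zero    = 0 , z≤n , z≤n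
halfCubeRoot (suc n) with halfCubeRoot n
... | v , lower , upper with suc n ℕ.≤? 8 * suc v ^ 3
... | yes n<  = v , ℕ.m≤n⇒m≤1+n lower , n<
... | no  n≮  = suc v , ℕ.<⇒≤ (ℕ.≰⇒> n≮) ,
  ℕ.≤-trans (s≤s upper) (ℕ.*-monoʳ-< 8 (ℕ.^-monoˡ-< 3 (ℕ.n<1+n (suc v))))

root : ℕ → ℕ
root n = proj₁ (halfCubeRoot n)

-- The root rounded up, for `balance` needs Δ ≤ 8u³, whereas the main term needs the root rounded
-- down. The discrepancy goes into `remainder`.
width : ℕ → ℕ
width n = suc (root n)

-- For β = Δ² + gap and k = β + surplus, the balance surplus · gap² ≥ 2Δ β² holds
-- with gap ≈ 2 Δ^(5/3) and surplus ≈ Δ^(5/3) / 2.  Their sum has the coefficient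
-- 5/2 < 2^(4/3); the even cube root 2u makes it an integral multiple of u⁵.
gap surplus : ℕ → ℕ
gap u = 64 * u ^ 5
surplus u = 16 * u ^ 3 * (suc u * suc u)

-- 448 = 80 · 5 + 32 + 16: the first summand pays for passing from u⁵ to v⁵ with u = v + 1, the
-- others for the lower terms of (u + 1)² in `surplus`.
remainder : ℕ → ℤ
remainder n = + (448 * width n ^ 4)

-- At Δ = 8u³ the sum Δ² + `gap u` factors as `gap u` times u + 1. The square of the gap then
-- cancels, and what remains, 2 · 8u³ · (u + 1)², is the definition of `surplus`.
balance : ∀ Δ u → Δ ≤ 8 * u ^ 3 → 2 * Δ * ((Δ ^ 2 + gap u) * (Δ ^ 2 + gap u)) ≤ surplus u * (gap u * gap u)
balance Δ u Δ≤ = begin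
  2 * Δ * ((Δ ^ 2 + gap u) * (Δ ^ 2 + gap u))
    ≤⟨ ℕ.*-mono-≤ (ℕ.*-monoʳ-≤ 2 Δ≤) (ℕ.*-mono-≤ β≤ β≤) ⟩
  2 * (8 * u ^ 3) * (64 * u ^ 5 * suc u * (64 * u ^ 5 * suc u))
    ≡⟨ regroup (u ^ 3) (64 * u ^ 5) (suc u) ⟩
  surplus u * (gap u * gap u) ∎
  where
  open ℕ.≤-Reasoning
  regroup : ∀ x t y → 2 * (8 * x) * (t * y * (t * y)) ≡ 16 * x * (y * y) * (t * t)
  regroup = solve-∀
  square : ∀ x → 8 * x * (8 * x * 1) ≡ 64 * (x * x)
  square = solve-∀
  factor : ∀ u x → 64 * (u * x) + 64 * x ≡ 64 * x * suc u
  factor = solve-∀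
  β≤ : Δ ^ 2 + gap u ≤ 64 * u ^ 5 * suc u
  β≤ = begin
    Δ ^ 2 + 64 * u ^ 5                 ≤⟨ ℕ.+-monoˡ-≤ (64 * u ^ 5) (ℕ.^-monoˡ-≤ 2 Δ≤) ⟩
    (8 * u ^ 3) ^ 2 + 64 * u ^ 5
      ≡⟨ cong (_+ 64 * u ^ 5) (trans (square (u ^ 3)) (cong (64 *_) (sym (ℕ.^-distribˡ-+-* u 3 3)))) ⟩
    64 * (u * u ^ 5) + 64 * u ^ 5      ≡⟨ factor u (u ^ 5) ⟩
    64 * u ^ 5 * suc u                 ∎

-- The mean value estimate for the power n + 1 on the interval from v to v + 1.
suc^-≤ : ∀ v n → suc v ^ suc n ≤ v ^ suc n + suc n * suc v ^ n
suc^-≤ v zero    = ℕ.≤-reflexive (identity v)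
  where
  identity : ∀ v → suc v * 1 ≡ v * 1 + 1
  identity = solve-∀
suc^-≤ v (suc n) = begin
  suc v ^ suc n + v * suc v ^ suc n
    ≤⟨ ℕ.+-monoʳ-≤ (suc v ^ suc n) (ℕ.*-monoʳ-≤ v (suc^-≤ v n)) ⟩
  -- The added term turns the coefficient `v` of `suc n * suc v ^ n` into `suc v`, so that it merges
  -- into the next power.
  suc v ^ suc n + v * (v ^ suc n + suc n * suc v ^ n)  ≤⟨ ℕ.m≤m+n _ (suc n * suc v ^ n) ⟩
  suc v ^ suc n + v * (v ^ suc n + suc n * suc v ^ n) + suc n * suc v ^ n
    ≡⟨ regroup v n (v ^ suc n) (suc v ^ n) ⟩
  v ^ suc (suc n) + suc (suc n) * suc v ^ suc n      ∎
  where
  open ℕ.≤-Reasoning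
  regroup : ∀ v n x y → suc v * y + v * (x + suc n * y) + suc n * y ≡ v * x + suc (suc n) * (suc v * y)
  regroup = solve-∀

gap+surplus≤ : ∀ v → gap (suc v) + surplus (suc v) ≤ 80 * v ^ 5 + 448 * suc v ^ 4
gap+surplus≤ v = begin
  gap u + surplus u                                     ≡⟨ expand u (u ^ 3) ⟩
  80 * u ^ 5 + (32 * u ^ 4 + 16 * u ^ 3)        ≤⟨ ℕ.+-mono-≤ (ℕ.*-monoʳ-≤ 80 (suc^-≤ v 4))
                                                     (ℕ.+-monoʳ-≤ (32 * u ^ 4) (ℕ.*-monoʳ-≤ 16 (ℕ.m≤n*m (u ^ 3) u))) ⟩
  80 * (v ^ 5 + 5 * u ^ 4) + (32 * u ^ 4 + 16 * u ^ 4)  ≡⟨ collect (v ^ 5) (u ^ 4) ⟩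
  80 * v ^ 5 + 448 * u ^ 4                      ∎
  where
  open ℕ.≤-Reasoning
  u = suc v
  expand : ∀ u x → 64 * (u * (u * x)) + 16 * x * (suc u * suc u) ≡
                   80 * (u * (u * x)) + (32 * (u * x) + 16 * x)
  expand = solve-∀
  collect : ∀ x y → 80 * (x + 5 * y) + (32 * y + 16 * y) ≡ 80 * x + 448 * y
  collect = solve-∀

remainder-O : IsO[n^4/3] remainder
remainder-O = 448 , 1 , λ n 1≤n → ≤∛-intro {n = 448 * width n ^ 4} ℤ.≤-refl (bound 448 n 1≤n)
  where
  open ℕ.≤-Reasoning
  width³≤ : ∀ n → 1 ≤ n → width n ^ 3 ≤ n
  width³≤ n 1≤n with halfCubeRoot n
  -- A root 0 has width 1, so the estimate starts at n = 1. A positive root at most doubles when 1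
  -- is added, and the factor 8 in `lower` absorbs the cube of 2.
  ... | zero  , _     , _ = 1≤n
  ... | suc v , lower , _ = begin
    suc (suc v) ^ 3  ≤⟨ ℕ.^-monoˡ-≤ 3 (s≤s (s≤s (ℕ.m≤m+n v v))) ⟩
    (2 + (v + v)) ^ 3 ≡⟨ cong (_^ 3) (twice v) ⟩
    (2 * suc v) ^ 3  ≡⟨ ^-distribʳ-* 2 (suc v) 3 ⟩
    8 * suc v ^ 3    ≤⟨ lower ⟩
    n                ∎
    where
    twice : ∀ v → 2 + (v + v) ≡ 2 * suc v
    twice = solve-∀

  bound : ∀ C n → 1 ≤ n → (C * width n ^ 4) ^ 3 ≤ C ^ 3 * n ^ 4
  bound C n 1≤n = begin
    (C * width n ^ 4) ^ 3    ≡⟨ ^-distribʳ-* C (width n ^ 4) 3 ⟩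
    C ^ 3 * (width n ^ 4) ^ 3  ≡⟨ cong (C ^ 3 *_) (^-swap (width n) 4 3) ⟩
    C ^ 3 * (width n ^ 3) ^ 4  ≤⟨ ℕ.*-monoʳ-≤ (C ^ 3) (ℕ.^-monoˡ-≤ 4 (width³≤ n 1≤n)) ⟩
    C ^ 3 * n ^ 4            ∎

main-term : ∀ Δ v → 8 * v ^ 3 ≤ Δ → (80 * v ^ 5) ^ 3 ≤ 2 ^ 4 * Δ ^ 5
main-term Δ v lower = begin
  (80 * v ^ 5) ^ 3            ≡⟨ ^-distribʳ-* 80 (v ^ 5) 3 ⟩
  -- This is (5/2)³ = 15.625 ≤ 16 = (2^(4/3))³, scaled by 32³: 512000 against 524288.
  80 ^ 3 * (v ^ 5) ^ 3        ≤⟨ ℕ.*-monoˡ-≤ ((v ^ 5) ^ 3) (ℕ.≤ᵇ⇒≤ (80 ^ 3) (2 ^ 4 * 8 ^ 5) _) ⟩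
  2 ^ 4 * 8 ^ 5 * (v ^ 5) ^ 3 ≡⟨ cong (2 ^ 4 * 8 ^ 5 *_) (^-swap v 5 3) ⟩
  2 ^ 4 * 8 ^ 5 * (v ^ 3) ^ 5 ≡⟨ ℕ.*-assoc (2 ^ 4) (8 ^ 5) ((v ^ 3) ^ 5) ⟩
  2 ^ 4 * (8 ^ 5 * (v ^ 3) ^ 5) ≡⟨ cong (2 ^ 4 *_) (^-distribʳ-* 8 (v ^ 3) 5) ⟨
  2 ^ 4 * (8 * v ^ 3) ^ 5     ≤⟨ ℕ.*-monoʳ-≤ (2 ^ 4) (ℕ.^-monoˡ-≤ 5 lower) ⟩
  2 ^ 4 * Δ ^ 5               ∎
  where open ℕ.≤-Reasoning

difference-≤ : ∀ p d f c → p ≤ d + (c + f) → + p - + d - + f ℤ.≤ + c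
difference-≤ p d f c p≤ = begin
  + p - + d - + f                      ≤⟨ ℤ.+-monoˡ-≤ (ℤ.- + f) (ℤ.+-monoˡ-≤ (ℤ.- + d) (ℤ.+≤+ p≤)) ⟩
  + (d + (c + f)) - + d - + f          ≡⟨ cong (λ x → x - + d - + f) (ℤ.pos-+ d (c + f)) ⟩
  + d ℤ.+ + (c + f) - + d - + f        ≡⟨ cong (λ x → x - + f) (cancel (+ d) (+ (c + f))) ⟩
  + (c + f) - + f
    ≡⟨ cong (_- + f) (trans (cong +_ (ℕ.+-comm c f)) (ℤ.pos-+ f c)) ⟩
  + f ℤ.+ + c - + f                    ≡⟨ cancel (+ f) (+ c) ⟩
  + c                                  ∎
  where
  open ℤ.≤-Reasoning
  cancel : ∀ x y → x ℤ.+ y - x ≡ y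
  cancel x y = begin-equality
    x ℤ.+ y - x          ≡⟨ cong (_- x) (ℤ.+-comm x y) ⟩
    y ℤ.+ x - x          ≡⟨ ℤ.+-assoc y x (ℤ.- x) ⟩
    y ℤ.+ (x - x)        ≡⟨ cong (λ z → y ℤ.+ z) (ℤ.+-inverseʳ x) ⟩
    y ℤ.+ + 0            ≡⟨ ℤ.+-identityʳ y ⟩
    y                    ∎

theorem6 : ∃[ f ] IsO[n^4/3] f ×
    (∀ (G : Graph) → let Δ = maxDegree G in 3 ≤ Δ →
    + π′ₗ G - + (Δ ^ 2) - f Δ ≤∛ + (2 ^ 4 * Δ ^ 5))
theorem6 = remainder , remainder-O , bound
  where
  bound : ∀ (G : Graph) → let Δ = maxDegree G in 3 ≤ Δ →
    + π′ₗ G - + (Δ ^ 2) - remainder Δ ≤∛ + (2 ^ 4 * Δ ^ 5)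
  bound G _ = ≤∛-intro {n = 80 * v ^ 5} (difference-≤ (π′ₗ G) (Δ ^ 2) (448 * u ^ 4) (80 * v ^ 5) π′≤)
    (main-term Δ v lower)
    where
    Δ = maxDegree G
    v = root Δ
    u = width Δ
    lower = proj₁ (proj₂ (halfCubeRoot Δ))
    upper = proj₂ (proj₂ (halfCubeRoot Δ))

    π′≤ : π′ₗ G ≤ Δ ^ 2 + (80 * v ^ 5 + 448 * u ^ 4)
    π′≤ = begin
      π′ₗ G
        ≤⟨ proj₂ (proj₂ (thueChoiceIndex G)) _
           (choosable G (gap u) (surplus u) {{ℕ.m*n≢0 64 (u ^ 5) {{_}} {{ℕ.m^n≢0 u 5}}}} (balance Δ u upper)) ⟩
      Δ ^ 2 + gap u + surplus u  ≡⟨ ℕ.+-assoc (Δ ^ 2) (gap u) (surplus u) ⟩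
      Δ ^ 2 + (gap u + surplus u) ≤⟨ ℕ.+-monoʳ-≤ (Δ ^ 2) (gap+surplus≤ v) ⟩
      Δ ^ 2 + (80 * v ^ 5 + 448 * u ^ 4) ∎
      where open ℕ.≤-Reasoning
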